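{- Let $n,m$ be positive integers and let $G$ be a simple graph. Then $G$ is isomorphic to the complete bipartite graph $K_{n,m}$ if and only if $$da(G;x,y) = nxy^{n} + mxy^{m} + y^{n+m}\sum_{i=1}^{n}\sum_{j=1}^{m} \binom{n}{i}\binom{m}{j} x^{i+j}y^{\min\{2i-n,\,2j-m\}}.$$
   Context: All graphs are finite, simple and have at least one vertex. For a graph $G$, $S\subseteq V(G)$ and $u\in V(G)$, let $\bar S=V(G)\setminus S$, let $\delta_S(u)=|\{v\in S:\{u,v\}\in E(G)\}|$, and let $G[S]$ be the subgraph induced by $S$. The defensive alliance polynomial of $G$ is $$da(G;x,y)=\sum_{S} x^{|S|}\,y^{f_y(S)},\qquad f_y(S)=\min_{u\in S}\bigl(\delta_S(u)-\delta_{\bar S}(u)+|V(G)|\bigr),$$ where the sum runs over all non-empty $S\subseteq V(G)$ such that $G[S]$ is connected (single-vertex graphs are connected). -}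

module Defs where

open import Data.Empty using (⊥)
open import Data.Fin using (Fin; splitAt)
open import Data.Fin.Properties using (any?; all?) renaming (_≟_ to _≟ᶠ_)
open import Data.Fin.Subset using (Subset; inside; outside; _∈_; _∩_; ∁; ∣_∣; Nonempty; _-_; _─_)
open import Data.Fin.Subset.Properties
  using (_∈?_; nonempty?; x∈⁅x⁆; x∈p∧x≢y⇒x∈p-y; p─q⊆p; x∈p⇒∣p-x∣<∣p∣)
open import Data.Integer as ℤ using (ℤ; +_)
open import Data.Integer.Properties using (≤-totalOrder)
open import Data.List using (List; []; _∷_; [_]; _++_; map; concatMap; filter; allFin; applyUpTo; cartesianProductWith)
open import Data.List.Extrema ≤-totalOrder using (min)
open import Data.Nat as ℕ using (ℕ; zero; suc; NonZero)
open import Data.Nat.Combinatorics using (_C_)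
open import Data.Nat.ListAction using (sum)
import Data.Nat.Properties as ℕₚ
open import Data.Product using (_×_; _,_; proj₁; proj₂; ∃)
open import Data.Sum using (_⊎_; inj₁; inj₂)
open import Data.Unit using (⊤; tt)
open import Data.Vec using ([]; _∷_; here; there; tabulate)
open import Function using (_⇔_; _↔_; _∘_; Inverse)
open import Relation.Binary using (Rel; Symmetric; Decidable)
open import Relation.Binary.Construct.Closure.ReflexiveTransitive using (Star; ε; _◅_)
open import Relation.Binary.PropositionalEquality using (_≡_; _≢_; refl)
open import Relation.Nullary using (¬_; Dec; yes; no; does; contradiction)
open import Relation.Nullary.Decidable using (_×-dec_; _→-dec_; map′)
open import Level using (0ℓ)

record Graph : Set₁ where
  field
    order      : ℕ
    .{{order≢0}} : NonZero order
    Adj        : Rel (Fin order) 0ℓ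
    adj?       : Decidable Adj
    adj-sym    : Symmetric Adj
    adj-irrefl : ∀ {u} → ¬ Adj u u

  Vertex : Set
  Vertex = Fin order

  neighbours : Vertex → Subset order
  neighbours u = tabulate (does ∘ adj? u)

open Graph

infix 4 _≅_

_≅_ : Graph → Graph → Set
G ≅ H = ∃ λ (φ : Vertex G ↔ Vertex H) →
  ∀ u v → Adj G u v ⇔ Adj H (Inverse.to φ u) (Inverse.to φ v)

OppositeSides : ∀ {A B : Set} → Rel (A ⊎ B) 0ℓ
OppositeSides (inj₁ _) (inj₁ _) = ⊥
OppositeSides (inj₁ _) (inj₂ _) = ⊤
OppositeSides (inj₂ _) (inj₁ _) = ⊤
OppositeSides (inj₂ _) (inj₂ _) = ⊥

oppositeSides? : ∀ {A B : Set} → Decidable (OppositeSides {A} {B})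
oppositeSides? (inj₁ _) (inj₁ _) = no λ ()
oppositeSides? (inj₁ _) (inj₂ _) = yes tt
oppositeSides? (inj₂ _) (inj₁ _) = yes tt
oppositeSides? (inj₂ _) (inj₂ _) = no λ ()

oppositeSides-sym : ∀ {A B : Set} → Symmetric (OppositeSides {A} {B})
oppositeSides-sym {x = inj₁ _} {inj₂ _} tt = tt
oppositeSides-sym {x = inj₂ _} {inj₁ _} tt = tt

oppositeSides-irrefl : ∀ {A B : Set} (x : A ⊎ B) → ¬ OppositeSides x x
oppositeSides-irrefl (inj₁ _) ()
oppositeSides-irrefl (inj₂ _) ()

n+m≢0 : ∀ n m → .{{NonZero n}} → NonZero (n ℕ.+ m)
n+m≢0 (suc _) _ = _

completeBipartite : (n m : ℕ) → .{{NonZero n}} → Graph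
completeBipartite n m = record
  { order      = n ℕ.+ m
  ; order≢0    = n+m≢0 n m
  ; Adj        = λ u v → OppositeSides (splitAt n u) (splitAt n v)
  ; adj?       = λ u v → oppositeSides? (splitAt n u) (splitAt n v)
  ; adj-sym    = λ {u} {v} → oppositeSides-sym {x = splitAt n u} {splitAt n v}
  ; adj-irrefl = λ {u} → oppositeSides-irrefl (splitAt n u)
  }

module _ (G : Graph) where

  -- G[S] is represented on the vertices of G, with those outside S isolated.
  InducedAdj : Subset (order G) → Rel (Vertex G) 0ℓ
  InducedAdj S u v = u ∈ S × v ∈ S × Adj G u v

  InducedConnected : Subset (order G) → Set
  InducedConnected S = ∀ u → u ∈ S → ∀ v → v ∈ S → Star (InducedAdj S) u v

  private
    inducedAdj? : ∀ S → Decidable (InducedAdj S)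
    inducedAdj? S u v = (u ∈? S) ×-dec ((v ∈? S) ×-dec adj? G u v)

    u∉S─T : ∀ {k} {S T : Subset k} {u} → u ∈ T → ¬ u ∈ S ─ T
    u∉S─T {S = _ ∷ _} {_ ∷ _} here         ()
    u∉S─T {S = _ ∷ _} {inside ∷ _}  (there u∈T) (there u∈) = u∉S─T u∈T u∈
    u∉S─T {S = _ ∷ _} {outside ∷ _} (there u∈T) (there u∈) = u∉S─T u∈T u∈

    stuck : ∀ {S u v} → u ≢ v → ¬ Star (InducedAdj (S - u)) u v
    stuck u≢v ε = u≢v refl
    stuck u≢v ((u∈ , _) ◅ _) = u∉S─T (x∈⁅x⁆ _) u∈

    -- Cut a walk after its last visit to u.
    lastVisit : ∀ {S u a v} → u ≢ v → Star (InducedAdj S) a v →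
                Star (InducedAdj (S - u)) a v
                ⊎ ∃ λ w → InducedAdj S u w × Star (InducedAdj (S - u)) w v
    lastVisit u≢v ε = inj₁ ε
    lastVisit {u = u} {a = a} u≢v (_◅_ {j = b} e@(a∈S , b∈S , ab) p) with lastVisit u≢v p
    ... | inj₂ r = inj₂ r
    ... | inj₁ q with a ≟ᶠ u
    ...   | yes refl = inj₂ (b , e , q)
    ...   | no a≢u with b ≟ᶠ u
    ...     | yes refl = contradiction q (stuck u≢v)
    ...     | no b≢u   = inj₁ ((x∈p∧x≢y⇒x∈p-y a∈S a≢u , x∈p∧x≢y⇒x∈p-y b∈S b≢u , ab) ◅ q)

    extend : ∀ {S u a v} → Star (InducedAdj (S - u)) a v → Star (InducedAdj S) a v
    extend ε = ε
    extend {S} ((a∈ , b∈ , ab) ◅ p) = (p─q⊆p S _ a∈ , p─q⊆p S _ b∈ , ab) ◅ extend p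

    -- Depth-first search: the bound k on ∣ S ∣ is only there for termination.
    walk? : ∀ k S → ∣ S ∣ ℕ.≤ k → Decidable (Star (InducedAdj S))
    walk? k S ∣S∣≤k u v with u ≟ᶠ v
    ... | yes refl = yes ε
    ... | no u≢v with u ∈? S
    ...   | no u∉S = no λ { ε → u≢v refl ; ((u∈S , _) ◅ _) → u∉S u∈S }
    walk? zero S ∣S∣≤k u v | no u≢v | yes u∈S =
      contradiction (ℕₚ.≤-trans (x∈p⇒∣p-x∣<∣p∣ u∈S) ∣S∣≤k) λ ()
    walk? (suc k) S ∣S∣≤k u v | no u≢v | yes u∈S =
      map′ (λ { (w , e , p) → e ◅ extend p }) split
           (any? λ w → inducedAdj? S u w
             ×-dec walk? k (S - u) (ℕ.s≤s⁻¹ (ℕₚ.≤-trans (x∈p⇒∣p-x∣<∣p∣ u∈S) ∣S∣≤k)) w v)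
      where
      split : Star (InducedAdj S) u v →
              ∃ λ w → InducedAdj S u w × Star (InducedAdj (S - u)) w v
      split p with lastVisit u≢v p
      ... | inj₁ q = contradiction q (stuck u≢v)
      ... | inj₂ r = r

  inducedConnected? : ∀ S → Dec (InducedConnected S)
  inducedConnected? S =
    all? λ u → (u ∈? S) →-dec (all? λ v → (v ∈? S) →-dec walk? ∣ S ∣ S ℕₚ.≤-refl u v)

-- A polynomial is a formal sum of monomials c xᵃ yᵇ, listed as (c , a , b);
-- negative powers of y are allowed, as y^min{2i−n, 2j−m} needs them.
-- The list is not canonical: equality of polynomials is _≈_.  Since ℕ embeds
-- in ℤ, _≈_ is also equality in ℤ[x, y, y⁻¹].
Poly : Set
Poly = List (ℕ × ℕ × ℤ)

infixl 6 _⊕_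
infixl 7 _⊗_
infix 4 _≈_

monomial : ℕ → ℕ → ℤ → Poly
monomial c a b = [ (c , a , b) ]

_⊕_ : Poly → Poly → Poly
_⊕_ = _++_

multiplyTerms : ℕ × ℕ × ℤ → ℕ × ℕ × ℤ → ℕ × ℕ × ℤ
multiplyTerms (c , a , b) (c′ , a′ , b′) = c ℕ.* c′ , a ℕ.+ a′ , b ℤ.+ b′

_⊗_ : Poly → Poly → Poly
_⊗_ = cartesianProductWith multiplyTerms

∑ : {A : Set} → List A → (A → Poly) → Poly
∑ xs f = concatMap f xs

coefficient : ℕ → ℤ → Poly → ℕ
coefficient a b p =
  sum (map proj₁ (filter (λ (_ , a′ , b′) → (a′ ℕ.≟ a) ×-dec (b′ ℤ.≟ b)) p))

_≈_ : Rel Poly 0ℓ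
p ≈ q = ∀ a b → coefficient a b p ≡ coefficient a b q

subsets : ∀ k → List (Subset k)
subsets zero    = [ [] ]
subsets (suc k) = map (outside ∷_) (subsets k) ++ map (inside ∷_) (subsets k)

module _ (G : Graph) where

  δ : Subset (order G) → Vertex G → ℕ
  δ S u = ∣ S ∩ neighbours G u ∣

  margin : Subset (order G) → Vertex G → ℤ
  margin S u = + δ S u ℤ.- + δ (∁ S) u ℤ.+ + order G

  -- min takes a default value, here the margin of some element of S, so that
  -- the result is the minimum over S.
  f-y : (S : Subset (order G)) → Nonempty S → ℤ
  f-y S (u , _) = min (margin S u) (map (margin S) (filter (_∈? S) (allFin (order G))))

  summand : ∀ S → Dec (Nonempty S × InducedConnected G S) → Poly
  summand S (yes (S≢∅ , _)) = monomial 1 ∣ S ∣ (f-y S S≢∅)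
  summand S (no _)          = []

  da : Poly
  da = ∑ (subsets (order G)) λ S → summand S (nonempty? S ×-dec inducedConnected? G S)

[1⋯_] : ℕ → List ℕ
[1⋯ n ] = applyUpTo suc n

bipartitePoly : ℕ → ℕ → Poly
bipartitePoly n m =
  monomial n 1 (+ n) ⊕ monomial m 1 (+ m) ⊕
  monomial 1 0 (+ (n ℕ.+ m)) ⊗
    ∑ [1⋯ n ] λ i → ∑ [1⋯ m ] λ j →
      monomial ((n C i) ℕ.* (m C j)) (i ℕ.+ j)
               ((+ (2 ℕ.* i) ℤ.- + n) ℤ.⊓ (+ (2 ℕ.* j) ℤ.- + m))

{-# OPTIONS --safe #-}
-- If G has sides A and ∁ A as in K_{n,m}, the contribution of S to da G depends
-- only on |S ∩ A| and |S ∩ ∁ A|, and summing over S gives the binomial double sum.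
--
-- Conversely, the terms linear in x give the degrees: n vertices of degree m and
-- m of degree n, so |V| = n + m.  A clique of k + 2 vertices, all of degree d,
-- contributes a term x^(k+2) y^(2(k+1) − d + |V|), which must then occur in the
-- double sum.  For k = 0 this shows that two adjacent vertices cannot both have
-- the smaller degree; so if n ≠ m, the low-degree class is independent, and each
-- of its vertices is joined to the whole high-degree class, having that many
-- neighbours.  For n = m and k = 1 it shows that G is triangle-free; being
-- n-regular on 2n vertices, G then has the sides N(u) and ∁ N(u) for every u.
module Submission where

open import Defs
open import Data.Bool using (Bool; true; false; not; if_then_else_)
open import Data.Bool.Properties using (¬-not)
open import Data.Fin using (Fin; zero; suc; splitAt)
open import Data.Fin.Permutation using (↔⇒≡)
open import Data.Fin.Properties using (splitAt-join; +↔⊎) renaming (_≟_ to _≟ᶠ_)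
open import Data.Fin.Subset
open import Data.Fin.Subset.Properties
open import Data.Integer as ℤ using (ℤ)
import Data.Integer.Properties as ℤₚ
open import Data.Integer.Solver using (module +-*-Solver)
open import Data.List as List using (List; []; _∷_; _++_; map; filter; applyUpTo; allFin)
open import Data.List.Extrema ℤₚ.≤-totalOrder using (min≈v⁺)
import Data.List.Membership.Propositional as List∈
open import Data.List.Membership.Propositional.Properties
  using (∈-map⁺; ∈-map⁻; ∈-filter⁺; ∈-filter⁻; ∈-allFin; ∈-concatMap⁺; ∈-++⁺ˡ; ∈-++⁺ʳ)
open import Data.List.Properties
  using (filter-++; filter-accept; filter-reject; map-++; map-∘; map-cong; map-concatMap; map-applyUpTo; ++-identityʳ)
import Data.List.Relation.Unary.All as All
open import Data.List.Relation.Unary.Any using (here; there)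
open import Data.Nat using (ℕ; zero; suc; NonZero; >-nonZero⁻¹; _+_; _*_; _<_; _≤_; z≤n; s≤s)
open import Data.Nat.Combinatorics using (_C_; nCk+nC[k+1]≡[n+1]C[k+1]; k>n⇒nCk≡0)
open import Data.Nat.ListAction using (sum)
open import Data.Nat.ListAction.Properties using (sum-++)
import Data.Nat.Properties as ℕₚ
open import Data.Product using (_×_; _,_; proj₁; proj₂; ∃)
open import Data.Product.Properties using () renaming (≡-dec to ×-≡-dec)
open import Data.Sum as Sum using (_⊎_; inj₁; inj₂; [_,_]′)
open import Data.Vec as Vec using ([]; _∷_; tabulate; lookup)
open import Data.Vec.Properties
  using ([]=⇒lookup; lookup⇒[]=; lookup∘tabulate; lookup-map; tabulate-cong; tabulate-∘)
open import Function using (_⇔_; _↔_; mk⇔; mk↔ₛ′; _∘_; case_of_; const; Inverse)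
open import Function.Construct.Composition using (_↔-∘_)
open import Function.Construct.Symmetry using (↔-sym)
open import Algebra.Properties.AbelianGroup ℤₚ.+-0-abelianGroup using () renaming (∙-cancelˡ to ℤ-∙-cancelˡ)
open import Algebra.Properties.CommutativeMonoid.Sum ℕₚ.+-0-commutativeMonoid
  using (sum-permute; sum-cong-≗) renaming (sum to ∑ᶠ)
open import Algebra.Properties.CommutativeSemigroup ℕₚ.+-commutativeSemigroup using (interchange)
open import Relation.Binary.Construct.Closure.ReflexiveTransitive using (ε; _◅_)
open import Relation.Binary.Definitions using (Tri; tri<; tri≈; tri>)
open import Relation.Binary.PropositionalEquality
open import Relation.Nullary using (¬_; Dec; yes; no; does; contradiction)
open import Relation.Nullary.Decidable using (_×-dec_; dec-true; dec-false; does-⇔; decidable-stable)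

open Graph

private
  variable
    k : ℕ

-- Cardinality and membership in finite subsets.

∣p∩q∣+∣p∩∁q∣≡∣p∣ : ∀ (p q : Subset k) → ∣ p ∩ q ∣ + ∣ p ∩ ∁ q ∣ ≡ ∣ p ∣
∣p∩q∣+∣p∩∁q∣≡∣p∣ []            []            = refl
∣p∩q∣+∣p∩∁q∣≡∣p∣ (outside ∷ p) (_ ∷ q)       = ∣p∩q∣+∣p∩∁q∣≡∣p∣ p q
∣p∩q∣+∣p∩∁q∣≡∣p∣ (inside ∷ p)  (inside ∷ q)  = cong suc (∣p∩q∣+∣p∩∁q∣≡∣p∣ p q)
∣p∩q∣+∣p∩∁q∣≡∣p∣ (inside ∷ p)  (outside ∷ q) =
  trans (ℕₚ.+-suc _ _) (cong suc (∣p∩q∣+∣p∩∁q∣≡∣p∣ p q))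

∣p∣+∣∁p∣≡n : ∀ (p : Subset k) → ∣ p ∣ + ∣ ∁ p ∣ ≡ k
∣p∣+∣∁p∣≡n {k} p = trans (cong (∣ p ∣ +_) (∣∁p∣≡n∸∣p∣ p)) (ℕₚ.m+[n∸m]≡n (∣p∣≤n p))

∁-involutive : ∀ (p : Subset k) → ∁ (∁ p) ≡ p
∁-involutive p = ⊆-antisym (x∉∁p⇒x∈p ∘ x∈∁p⇒x∉p) (x∉p⇒x∈∁p ∘ x∈p⇒x∉∁p)

∣⁅x⁆∪p∣≡1+∣p∣ : ∀ {x} {p : Subset k} → x ∉ p → ∣ ⁅ x ⁆ ∪ p ∣ ≡ suc ∣ p ∣
∣⁅x⁆∪p∣≡1+∣p∣ {x = zero}  {inside ∷ p}  x∉p = contradiction Vec.here x∉p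
∣⁅x⁆∪p∣≡1+∣p∣ {x = zero}  {outside ∷ p} x∉p = cong (suc ∘ ∣_∣) (∪-identityˡ p)
∣⁅x⁆∪p∣≡1+∣p∣ {x = suc x} {inside ∷ p}  x∉p = cong suc (∣⁅x⁆∪p∣≡1+∣p∣ (x∉p ∘ Vec.there))
∣⁅x⁆∪p∣≡1+∣p∣ {x = suc x} {outside ∷ p} x∉p = ∣⁅x⁆∪p∣≡1+∣p∣ (x∉p ∘ Vec.there)

-- An element of `q` outside `p` would make `p` strictly smaller than `q`. Neighbourhoods are
-- identified this way, from one inclusion and a degree count.
p⊆q∧∣q∣≤∣p∣⇒p≡q : ∀ {p q : Subset k} → p ⊆ q → ∣ q ∣ ≤ ∣ p ∣ → p ≡ q
p⊆q∧∣q∣≤∣p∣⇒p≡q {p = p} p⊆q ∣q∣≤∣p∣ = ⊆-antisym p⊆q λ {x} x∈q → case (x ∈? p) x∈q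
  where
  case : ∀ {x} → Dec (x ∈ p) → x ∈ _ → x ∈ p
  case (yes x∈p) _   = x∈p
  case (no x∉p)  x∈q = contradiction ∣q∣≤∣p∣ (ℕₚ.<⇒≱ (p⊂q⇒∣p∣<∣q∣ (p⊆q , _ , x∈q , x∉p)))

0<∣p∣⇒Nonempty : ∀ (p : Subset k) → 0 < ∣ p ∣ → Nonempty p
0<∣p∣⇒Nonempty (inside ∷ p)  _ = zero , Vec.here
0<∣p∣⇒Nonempty (outside ∷ p) 0<∣p∣ with 0<∣p∣⇒Nonempty p 0<∣p∣
... | x , x∈p = suc x , Vec.there x∈p

∣p∣≡0⇒p≡⊥ : ∀ (p : Subset k) → ∣ p ∣ ≡ 0 → p ≡ ⊥
∣p∣≡0⇒p≡⊥ []            _     = refl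
∣p∣≡0⇒p≡⊥ (outside ∷ p) ∣p∣≡0 = cong (outside ∷_) (∣p∣≡0⇒p≡⊥ p ∣p∣≡0)

∣p∣≡1⇒p≡⁅x⁆ : ∀ (p : Subset k) → ∣ p ∣ ≡ 1 → ∃ λ x → p ≡ ⁅ x ⁆
∣p∣≡1⇒p≡⁅x⁆ (inside ∷ p)  ∣p∣≡1 = zero , cong (inside ∷_) (∣p∣≡0⇒p≡⊥ p (ℕₚ.suc-injective ∣p∣≡1))
∣p∣≡1⇒p≡⁅x⁆ (outside ∷ p) ∣p∣≡1 with ∣p∣≡1⇒p≡⁅x⁆ p ∣p∣≡1
... | x , refl = suc x , refl

∈-tabulate⁺ : ∀ {f : Fin k → Bool} {x} → f x ≡ true → x ∈ tabulate f
∈-tabulate⁺ {f = f} {x} fx = lookup⇒[]= x _ (trans (lookup∘tabulate f x) fx)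

∈-tabulate⁻ : ∀ {f : Fin k → Bool} {x} → x ∈ tabulate f → f x ≡ true
∈-tabulate⁻ {f = f} {x} x∈ = trans (sym (lookup∘tabulate f x)) ([]=⇒lookup x∈)

∈-subsets : ∀ (S : Subset k) → S List∈.∈ subsets k
∈-subsets []            = here refl
∈-subsets (outside ∷ S) = ∈-++⁺ˡ (∈-map⁺ (outside ∷_) (∈-subsets S))
∈-subsets {suc k} (inside ∷ S) = ∈-++⁺ʳ (map (outside ∷_) (subsets k)) (∈-map⁺ (inside ∷_) (∈-subsets S))

-- Sums over subsets and binomial sums.

indicator : Bool → ℕ
indicator b = if b then 1 else 0

-- As a sum over `Fin`, a cardinality can be compared with a sum over singletons and reindexed along
-- a bijection.
∣tabulate∣ : (f : Fin k → Bool) → ∣ tabulate f ∣ ≡ ∑ᶠ (indicator ∘ f)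
∣tabulate∣ {zero}  f = refl
∣tabulate∣ {suc k} f with f zero
... | true  = cong suc (∣tabulate∣ (f ∘ suc))
... | false = ∣tabulate∣ (f ∘ suc)

sum-subsets-suc : (F : Subset (suc k) → ℕ) → sum (map F (subsets (suc k))) ≡
  sum (map (F ∘ (outside ∷_)) (subsets k)) + sum (map (F ∘ (inside ∷_)) (subsets k))
sum-subsets-suc {k} F = begin
  sum (map F (out ++ ins))           ≡⟨ cong sum (map-++ F out ins) ⟩
  sum (map F out ++ map F ins)       ≡⟨ sum-++ (map F out) (map F ins) ⟩
  sum (map F out) + sum (map F ins)  ≡⟨ cong₂ (λ xs ys → sum xs + sum ys) (map-∘ (subsets k)) (map-∘ (subsets k)) ⟨
  sum (map (F ∘ (outside ∷_)) (subsets k)) + sum (map (F ∘ (inside ∷_)) (subsets k)) ∎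
  where
  open ≡-Reasoning
  out = map (outside ∷_) (subsets k)
  ins = map (inside ∷_) (subsets k)

sum-map-zero : ∀ {A : Set} (F : A → ℕ) xs → (∀ x → F x ≡ 0) → sum (map F xs) ≡ 0
sum-map-zero F []       F≡0 = refl
sum-map-zero F (x ∷ xs) F≡0 = cong₂ _+_ (F≡0 x) (sum-map-zero F xs F≡0)

sum-empty : (F : Subset k → ℕ) → (∀ S → ∣ S ∣ ≢ 0 → F S ≡ 0) → sum (map F (subsets k)) ≡ F ⊥
sum-empty {zero}  F _ = ℕₚ.+-identityʳ _
sum-empty {suc k} F F≡0 = begin
  sum (map F (subsets (suc k)))  ≡⟨ sum-subsets-suc F ⟩
  sum (map (F ∘ (outside ∷_)) (subsets k)) + sum (map (F ∘ (inside ∷_)) (subsets k))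
    ≡⟨ cong₂ _+_ (sum-empty (F ∘ (outside ∷_)) (F≡0 ∘ (outside ∷_)))
                 (sum-map-zero _ (subsets k) λ S → F≡0 (inside ∷ S) λ ()) ⟩
  F ⊥ + 0                        ≡⟨ ℕₚ.+-identityʳ _ ⟩
  F ⊥                            ∎
  where open ≡-Reasoning

-- Induction on the ground set: among the sets without the first element the induction hypothesis
-- applies; among those with it, only the one with empty remainder can contribute.
sum-singletons : (F : Subset k → ℕ) → (∀ S → ∣ S ∣ ≢ 1 → F S ≡ 0) →
                 sum (map F (subsets k)) ≡ ∑ᶠ (F ∘ ⁅_⁆)
sum-singletons {zero}  F F≡0 = trans (ℕₚ.+-identityʳ _) (F≡0 [] λ ())
sum-singletons {suc k} F F≡0 = begin
  sum (map F (subsets (suc k)))  ≡⟨ sum-subsets-suc F ⟩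
  sum (map (F ∘ (outside ∷_)) (subsets k)) + sum (map (F ∘ (inside ∷_)) (subsets k))
    ≡⟨ cong₂ _+_ (sum-singletons (F ∘ (outside ∷_)) (F≡0 ∘ (outside ∷_)))
                 (sum-empty (F ∘ (inside ∷_)) λ S ∣S∣≢0 → F≡0 (inside ∷ S) (∣S∣≢0 ∘ ℕₚ.suc-injective)) ⟩
  ∑ᶠ (F ∘ ⁅_⁆ ∘ suc) + F ⁅ zero ⁆ ≡⟨ ℕₚ.+-comm _ (F ⁅ zero ⁆) ⟩
  ∑ᶠ (F ∘ ⁅_⁆)                   ∎
  where open ≡-Reasoning

-- This is the sum of `(n C i) * f i` over `0 ≤ i ≤ n`, defined through Pascal's rule so that its
-- recursion matches that of `subsets`: a new element is either left out or raises the index by one.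
binomialSum : ℕ → (ℕ → ℕ) → ℕ
binomialSum zero    f = f 0
binomialSum (suc n) f = binomialSum n f + binomialSum n (f ∘ suc)

binomialSum-cong : ∀ n {f g : ℕ → ℕ} → f ≗ g → binomialSum n f ≡ binomialSum n g
binomialSum-cong zero    f≗g = f≗g 0
binomialSum-cong (suc n) f≗g = cong₂ _+_ (binomialSum-cong n f≗g) (binomialSum-cong n (f≗g ∘ suc))

binomialSum-+ : ∀ n f g → binomialSum n (λ i → f i + g i) ≡ binomialSum n f + binomialSum n g
binomialSum-+ zero    f g = refl
binomialSum-+ (suc n) f g = trans
  (cong₂ _+_ (binomialSum-+ n f g) (binomialSum-+ n (f ∘ suc) (g ∘ suc)))
  (interchange (binomialSum n f) (binomialSum n g) _ _)

sum-applyUpTo-+ : ∀ n (f g : ℕ → ℕ) →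
  sum (applyUpTo (λ i → f i + g i) n) ≡ sum (applyUpTo f n) + sum (applyUpTo g n)
sum-applyUpTo-+ zero    f g = refl
sum-applyUpTo-+ (suc n) f g = trans
  (cong (f 0 + g 0 +_) (sum-applyUpTo-+ n (f ∘ suc) (g ∘ suc)))
  (interchange (f 0) (g 0) _ _)

sum-applyUpTo-cong : ∀ n {f g : ℕ → ℕ} → f ≗ g → sum (applyUpTo f n) ≡ sum (applyUpTo g n)
sum-applyUpTo-cong zero    f≗g = refl
sum-applyUpTo-cong (suc n) f≗g = cong₂ _+_ (f≗g 0) (sum-applyUpTo-cong n (f≗g ∘ suc))

sum-applyUpTo-last : ∀ n (f : ℕ → ℕ) → sum (applyUpTo f (suc n)) ≡ sum (applyUpTo f n) + f n
sum-applyUpTo-last zero    f = ℕₚ.+-identityʳ (f 0)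
sum-applyUpTo-last (suc n) f = trans
  (cong (f 0 +_) (sum-applyUpTo-last n (f ∘ suc))) (sym (ℕₚ.+-assoc (f 0) _ _))

-- By Pascal's rule, the weight of `f (suc i)` collects `n C suc i` from the first half of the
-- recursion and `n C i` from the second.
binomialSum-closed : ∀ n f → binomialSum n f ≡ sum (applyUpTo (λ i → (n C i) * f i) (suc n))
binomialSum-closed zero    f = sym (trans (ℕₚ.+-identityʳ (1 * f 0)) (ℕₚ.*-identityˡ (f 0)))
binomialSum-closed (suc n) f = begin
  binomialSum n f + binomialSum n (f ∘ suc)
    ≡⟨ cong₂ _+_ (binomialSum-closed n f) (binomialSum-closed n (f ∘ suc)) ⟩
  sum (applyUpTo old (suc n)) + sum (applyUpTo (λ i → (n C i) * f (suc i)) (suc n))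
    ≡⟨ cong (_+ sum (applyUpTo (λ i → (n C i) * f (suc i)) (suc n))) old-extend ⟩
  (old 0 + sum (applyUpTo (old ∘ suc) (suc n))) + sum (applyUpTo (λ i → (n C i) * f (suc i)) (suc n))
    ≡⟨ ℕₚ.+-assoc (old 0) _ _ ⟩
  old 0 + (sum (applyUpTo (old ∘ suc) (suc n)) + sum (applyUpTo (λ i → (n C i) * f (suc i)) (suc n)))
    ≡⟨ cong (old 0 +_) (sum-applyUpTo-+ (suc n) (old ∘ suc) (λ i → (n C i) * f (suc i))) ⟨
  old 0 + sum (applyUpTo (λ i → (n C suc i) * f (suc i) + (n C i) * f (suc i)) (suc n))
    ≡⟨ cong (old 0 +_) (sum-applyUpTo-cong (suc n) pascal) ⟩
  sum (applyUpTo (λ i → (suc n C i) * f i) (suc (suc n))) ∎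
  where
  open ≡-Reasoning
  old : ℕ → ℕ
  old i = (n C i) * f i

  -- The extra term vanishes because `n C suc n` is zero. With it, splitting off term 0 leaves
  -- `suc n` terms, as many as in the second half.
  old-extend : sum (applyUpTo old (suc n)) ≡ sum (applyUpTo old (suc (suc n)))
  old-extend = sym (begin
    sum (applyUpTo old (suc (suc n)))       ≡⟨ sum-applyUpTo-last (suc n) old ⟩
    sum (applyUpTo old (suc n)) + old (suc n)
      ≡⟨ cong (λ c → sum (applyUpTo old (suc n)) + c * f (suc n)) (k>n⇒nCk≡0 (ℕₚ.n<1+n n)) ⟩
    sum (applyUpTo old (suc n)) + 0         ≡⟨ ℕₚ.+-identityʳ _ ⟩
    sum (applyUpTo old (suc n))             ∎)

  pascal : ∀ i → (n C suc i) * f (suc i) + (n C i) * f (suc i) ≡ (suc n C suc i) * f (suc i)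
  pascal i = begin
    (n C suc i) * f (suc i) + (n C i) * f (suc i) ≡⟨ ℕₚ.*-distribʳ-+ (f (suc i)) (n C suc i) (n C i) ⟨
    (n C suc i + n C i) * f (suc i)
      ≡⟨ cong (_* f (suc i)) (trans (ℕₚ.+-comm (n C suc i) _) (nCk+nC[k+1]≡[n+1]C[k+1] n i)) ⟩
    (suc n C suc i) * f (suc i) ∎

-- A new element raises the first count if it lies in `A` and the second otherwise, so induction on
-- `A` unfolds the outer or the inner binomial sum. In the inner case `binomialSum-+` splits the sum
-- under the outer index.
sum-subsets-split : (A : Subset k) (g : ℕ → ℕ → ℕ) →
  sum (map (λ S → g ∣ S ∩ A ∣ ∣ S ∩ ∁ A ∣) (subsets k)) ≡
  binomialSum ∣ A ∣ (λ i → binomialSum ∣ ∁ A ∣ (g i))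
sum-subsets-split []            g = ℕₚ.+-identityʳ _
sum-subsets-split (inside ∷ A)  g = trans (sum-subsets-suc (λ S → g ∣ S ∩ (inside ∷ A) ∣ ∣ S ∩ ∁ (inside ∷ A) ∣))
  (cong₂ _+_ (sum-subsets-split A g) (sum-subsets-split A (g ∘ suc)))
sum-subsets-split (outside ∷ A) g = trans (sum-subsets-suc (λ S → g ∣ S ∩ (outside ∷ A) ∣ ∣ S ∩ ∁ (outside ∷ A) ∣)) (trans
  (cong₂ _+_ (sum-subsets-split A g) (sum-subsets-split A (λ i j → g i (suc j))))
  (sym (binomialSum-+ ∣ A ∣ _ _)))

-- Coefficients of formal polynomials.

coefficient-++ : ∀ a b p q → coefficient a b (p ++ q) ≡ coefficient a b p + coefficient a b q
coefficient-++ a b p q = begin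
  sum (map proj₁ (filter match? (p ++ q)))             ≡⟨ cong (sum ∘ map proj₁) (filter-++ match? p q) ⟩
  sum (map proj₁ (filter match? p ++ filter match? q)) ≡⟨ cong sum (map-++ proj₁ (filter match? p) _) ⟩
  _                                                    ≡⟨ sum-++ (map proj₁ (filter match? p)) _ ⟩
  coefficient a b p + coefficient a b q                ∎
  where
  open ≡-Reasoning
  match? = λ ((_ , a′ , b′) : ℕ × ℕ × ℤ) → (a′ ℕₚ.≟ a) ×-dec (b′ ℤ.≟ b)

coefficient-∑ : ∀ {A : Set} a b (xs : List A) f →
                coefficient a b (∑ xs f) ≡ sum (map (coefficient a b ∘ f) xs)
coefficient-∑ a b []       f = refl
coefficient-∑ a b (x ∷ xs) f =
  trans (coefficient-++ a b (f x) _) (cong (coefficient a b (f x) +_) (coefficient-∑ a b xs f))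

coefficient-monomial : ∀ a b c a′ b′ →
  coefficient a b (monomial c a′ b′) ≡ c * coefficient a b (monomial 1 a′ b′)
coefficient-monomial a b c a′ b′ with does (a′ ℕₚ.≟ a) | does (b′ ℤ.≟ b)
... | true  | true  = trans (ℕₚ.+-identityʳ c) (sym (ℕₚ.*-identityʳ c))
... | true  | false = sym (ℕₚ.*-zeroʳ c)
... | false | _     = sym (ℕₚ.*-zeroʳ c)

coefficient-here : ∀ {a b} (t : ℕ × ℕ × ℤ) p → proj₂ t ≡ (a , b) →
                   coefficient a b (t ∷ p) ≡ proj₁ t + coefficient a b p
coefficient-here {a} {b} t p refl =
  cong (sum ∘ map proj₁) (filter-accept (λ (_ , a′ , b′) → (a′ ℕₚ.≟ a) ×-dec (b′ ℤ.≟ b)) {x = t} {xs = p} (refl , refl))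

coefficient-there : ∀ {a b} (t : ℕ × ℕ × ℤ) p → proj₂ t ≢ (a , b) →
                    coefficient a b (t ∷ p) ≡ coefficient a b p
coefficient-there {a} {b} t p ≢ab =
  cong (sum ∘ map proj₁) (filter-reject (λ (_ , a′ , b′) → (a′ ℕₚ.≟ a) ×-dec (b′ ℤ.≟ b)) {x = t} {xs = p}
    λ (a′≡a , b′≡b) → ≢ab (cong₂ _,_ a′≡a b′≡b))

coefficient≢0⇒∈ : ∀ {a b} p → coefficient a b p ≢ 0 → ∃ λ c → (c , a , b) List∈.∈ p
coefficient≢0⇒∈ []      ≢0 = contradiction refl ≢0
coefficient≢0⇒∈ {a} {b} (t ∷ p) ≢0 = cases (×-≡-dec ℕₚ._≟_ ℤ._≟_ (proj₂ t) (a , b))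
  where
  cases : Dec (proj₂ t ≡ (a , b)) → ∃ λ c → (c , a , b) List∈.∈ t ∷ p
  cases (yes refl) = proj₁ t , here refl
  cases (no t≢ab) with coefficient≢0⇒∈ p (≢0 ∘ trans (coefficient-there t p t≢ab))
  ... | c , ∈p = c , there ∈p

-- Coefficients are natural numbers, so a term with a positive one cannot be cancelled by the
-- others.
∈⇒coefficient≢0 : ∀ {c a b p} → (suc c , a , b) List∈.∈ p → coefficient a b p ≢ 0
∈⇒coefficient≢0 {p = t ∷ p} (here refl) ≡0 = ℕₚ.1+n≢0 (trans (sym (coefficient-here t p refl)) ≡0)
∈⇒coefficient≢0 {a = a} {b} {t ∷ p} (there ∈p) ≡0 =
  ∈⇒coefficient≢0 ∈p (ℕₚ.m+n≡0⇒n≡0 (coefficient a b List.[ t ]) (trans (sym (coefficient-++ a b List.[ t ] p)) ≡0))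

-- Degrees, margins and cliques.

module _ (G : Graph) where

  private
    N = order G

  degree : Vertex G → ℕ
  degree u = ∣ neighbours G u ∣

  ∈-neighbours⁺ : ∀ {u v} → Adj G u v → v ∈ neighbours G u
  ∈-neighbours⁺ {u} {v} uv = ∈-tabulate⁺ (dec-true (adj? G u v) uv)

  ∈-neighbours⁻ : ∀ {u v} → v ∈ neighbours G u → Adj G u v
  ∈-neighbours⁻ {u} {v} v∈ with adj? G u v | ∈-tabulate⁻ {f = does ∘ adj? G u} v∈
  ... | yes uv | _  = uv
  ... | no _   | ()

  neighbours-sym : ∀ {u v} → v ∈ neighbours G u → u ∈ neighbours G v
  neighbours-sym = ∈-neighbours⁺ ∘ adj-sym G ∘ ∈-neighbours⁻

  δ+δ∁≡degree : ∀ S u → δ G S u + δ G (∁ S) u ≡ degree u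
  δ+δ∁≡degree S u = begin
    ∣ S ∩ Nu ∣ + ∣ ∁ S ∩ Nu ∣  ≡⟨ cong₂ (λ p q → ∣ p ∣ + ∣ q ∣) (∩-comm S Nu) (∩-comm (∁ S) Nu) ⟩
    ∣ Nu ∩ S ∣ + ∣ Nu ∩ ∁ S ∣  ≡⟨ ∣p∩q∣+∣p∩∁q∣≡∣p∣ Nu S ⟩
    ∣ Nu ∣                     ∎
    where
    open ≡-Reasoning
    Nu = neighbours G u

  -- With d - k neighbours outside `S`, the margin becomes 2k - d + N, the shape of the exponents in
  -- the double sum.
  margin-degree : ∀ {S u d k} → δ G S u ≡ k → degree u ≡ d →
                  margin G S u ≡ ℤ.+ (2 * k) ℤ.- ℤ.+ d ℤ.+ ℤ.+ N
  margin-degree {S} {u} refl refl = begin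
    ℤ.+ i ℤ.- ℤ.+ j ℤ.+ ℤ.+ N                      ≡⟨ regroup (ℤ.+ i) (ℤ.+ j) (ℤ.+ N) ⟩
    ℤ.+ i ℤ.+ (ℤ.+ i ℤ.+ ℤ.+ 0) ℤ.- (ℤ.+ i ℤ.+ ℤ.+ j) ℤ.+ ℤ.+ N
      ≡⟨ cong (λ d → ℤ.+ (2 * i) ℤ.- ℤ.+ d ℤ.+ ℤ.+ N) (δ+δ∁≡degree S u) ⟩
    ℤ.+ (2 * i) ℤ.- ℤ.+ degree u ℤ.+ ℤ.+ N         ∎
    where
    open ≡-Reasoning
    open +-*-Solver
    i = δ G S u
    j = δ G (∁ S) u
    -- `2 * i` computes to `i + (i + 0)`, which accounts for the zero given to the solver.
    regroup : ∀ i j n → i ℤ.- j ℤ.+ n ≡ i ℤ.+ (i ℤ.+ ℤ.+ 0) ℤ.- (i ℤ.+ j) ℤ.+ n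
    regroup = solve 3 (λ i j n → i :- j :+ n := i :+ (i :+ con (ℤ.+ 0)) :- (i :+ j) :+ n) refl

  -- The default value of `min` is the margin of the vertex witnessing non-emptiness, so it obeys
  -- the same lower bound as the listed values. An attained lower bound is therefore the minimum,
  -- whichever witness is used.
  f-y-unique : ∀ {S b} (S≢∅ : Nonempty S) → (∀ {u} → u ∈ S → b ℤ.≤ margin G S u) →
               (∃ λ u → u ∈ S × margin G S u ≡ b) → f-y G S S≢∅ ≡ b
  f-y-unique {S} (v , v∈S) lower (u , u∈S , refl) =
    min≈v⁺ (∈-map⁺ (margin G S) (∈-filter⁺ (_∈? S) (∈-allFin u) u∈S))
           (All.tabulate below) (lower v∈S)
    where
    below : ∀ {c} → c List∈.∈ map (margin G S) (filter (_∈? S) (allFin N)) → margin G S u ℤ.≤ c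
    below c∈ with ∈-map⁻ (margin G S) c∈
    ... | w , w∈ , refl = lower (proj₂ (∈-filter⁻ (_∈? S) {xs = allFin N} w∈))

  -- The term of `S` has coefficient 1 and cannot cancel. Its exponent is required for every proof
  -- of non-emptiness because the one inside `da` comes from the decision procedure.
  connected⇒coefficient≢0 : ∀ {S a b} → Nonempty S → InducedConnected G S → ∣ S ∣ ≡ a →
    (∀ S≢∅ → f-y G S S≢∅ ≡ b) → coefficient a b (da G) ≢ 0
  connected⇒coefficient≢0 {S} {a} {b} S≢∅ connected refl f≡b = ∈⇒coefficient≢0 {c = 0}
    (∈-concatMap⁺ term (List∈.lose (∈-subsets S) (∈-summand _)))
    where
    term : Subset N → Poly
    term T = summand G T (nonempty? T ×-dec inducedConnected? G T)

    ∈-summand : ∀ d → (1 , a , b) List∈.∈ summand G S d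
    ∈-summand (yes (S≢∅ , _)) = here (cong (λ c → 1 , a , c) (sym (f≡b S≢∅)))
    ∈-summand (no ¬valid)     = contradiction (S≢∅ , connected) ¬valid

  Clique : Subset N → Set
  Clique S = ∀ {u v} → u ∈ S → v ∈ S → u ≢ v → Adj G u v

  module _ {S : Subset N} (clique : Clique S) where

    clique-connected : InducedConnected G S
    clique-connected u u∈S v v∈S with u ≟ᶠ v
    ... | yes refl = ε
    ... | no u≢v   = (u∈S , v∈S , clique u∈S v∈S u≢v) ◅ ε

    -- The only vertex of a clique not adjacent to `u` is `u` itself, so removing the neighbours of
    -- `u` from `S` leaves `⁅ u ⁆`.
    clique-δ : ∀ {u} → u ∈ S → δ G S u + 1 ≡ ∣ S ∣
    clique-δ {u} u∈S = begin
      ∣ S ∩ Nu ∣ + 1            ≡⟨ cong (∣ S ∩ Nu ∣ +_) (∣⁅x⁆∣≡1 u) ⟨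
      ∣ S ∩ Nu ∣ + ∣ ⁅ u ⁆ ∣    ≡⟨ cong (λ p → ∣ S ∩ Nu ∣ + ∣ p ∣) (⊆-antisym u⊆ ⊆u) ⟩
      ∣ S ∩ Nu ∣ + ∣ S ∩ ∁ Nu ∣ ≡⟨ ∣p∩q∣+∣p∩∁q∣≡∣p∣ S Nu ⟩
      ∣ S ∣                     ∎
      where
      open ≡-Reasoning
      Nu = neighbours G u
      u⊆ : ⁅ u ⁆ ⊆ S ∩ ∁ Nu
      u⊆ x∈ with x∈⁅y⁆⇒x≡y u x∈
      ... | refl = x∈p∩q⁺ (u∈S , x∉p⇒x∈∁p (adj-irrefl G ∘ ∈-neighbours⁻))
      ⊆u : S ∩ ∁ Nu ⊆ ⁅ u ⁆
      ⊆u {x} x∈ with x∈p∩q⁻ S (∁ Nu) x∈ | u ≟ᶠ x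
      ... | _         | yes refl = x∈⁅x⁆ x
      ... | x∈S , x∈∁ | no u≢x   = contradiction (∈-neighbours⁺ (clique u∈S x∈S u≢x)) (x∈∁p⇒x∉p x∈∁)

    -- Every vertex of the clique has `k` neighbours inside it and degree `d`, so all margins agree.
    clique-f-y : ∀ {k d} → ∣ S ∣ ≡ suc k → (∀ {u} → u ∈ S → degree u ≡ d) →
                 ∀ S≢∅ → f-y G S S≢∅ ≡ ℤ.+ (2 * k) ℤ.- ℤ.+ d ℤ.+ ℤ.+ N
    clique-f-y {k} {d} ∣S∣≡1+k degree≡d S≢∅@(v , v∈S) =
      f-y-unique S≢∅ (ℤₚ.≤-reflexive ∘ sym ∘ margin≡) (v , v∈S , margin≡ v∈S)
      where
      margin≡ : ∀ {u} → u ∈ S → margin G S u ≡ ℤ.+ (2 * k) ℤ.- ℤ.+ d ℤ.+ ℤ.+ N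
      margin≡ {u} u∈S = margin-degree {S} {u}
        (ℕₚ.suc-injective (trans (ℕₚ.+-comm 1 _) (trans (clique-δ u∈S) ∣S∣≡1+k))) (degree≡d u∈S)

  ⁅⁆-clique : ∀ u → Clique ⁅ u ⁆
  ⁅⁆-clique u x∈ y∈ x≢y = contradiction (trans (x∈⁅y⁆⇒x≡y u x∈) (sym (x∈⁅y⁆⇒x≡y u y∈))) x≢y

  ∪-clique : ∀ {u S} → (∀ {v} → v ∈ S → Adj G u v) → Clique S → Clique (⁅ u ⁆ ∪ S)
  ∪-clique {u} {S} uS clique {x} {y} x∈ y∈ x≢y with x∈p∪q⁻ ⁅ u ⁆ S x∈ | x∈p∪q⁻ ⁅ u ⁆ S y∈
  ... | inj₁ x∈u | inj₁ y∈u = ⁅⁆-clique u x∈u y∈u x≢y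
  ... | inj₂ x∈S | inj₂ y∈S = clique x∈S y∈S x≢y
  ... | inj₁ x∈u | inj₂ y∈S rewrite x∈⁅y⁆⇒x≡y u x∈u = uS y∈S
  ... | inj₂ x∈S | inj₁ y∈u rewrite x∈⁅y⁆⇒x≡y u y∈u = adj-sym G (uS x∈S)

  -- A walk in `S` from a fixed vertex `x` to a different one would start with an edge inside `S`.
  edgeless-connected⇒∣S∣≤1 : ∀ {S} → (∀ {u v} → u ∈ S → v ∈ S → ¬ Adj G u v) →
                             InducedConnected G S → ∣ S ∣ ≤ 1
  edgeless-connected⇒∣S∣≤1 {S} edgeless connected with nonempty? S
  ... | no S≡∅ = ℕₚ.≮⇒≥ λ 1<∣S∣ → S≡∅ (0<∣p∣⇒Nonempty S (ℕₚ.<-trans (ℕₚ.n<1+n 0) 1<∣S∣))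
  ... | yes (x , x∈S) = subst (∣ S ∣ ≤_) (∣⁅x⁆∣≡1 x) (p⊆q⇒∣p∣≤∣q∣ S⊆x)
    where
    S⊆x : S ⊆ ⁅ x ⁆
    S⊆x {y} y∈S with connected x x∈S y y∈S
    ... | ε                  = x∈⁅x⁆ x
    ... | (_ , w∈S , xw) ◅ _ = contradiction xw (edgeless x∈S w∈S)

  -- Both implications of the theorem pass through this notion. Stating adjacency as an equality of
  -- subsets lets degrees and `δ` be computed by substitution.
  record IsCompleteBipartition (A : Subset N) : Set where
    field
      neighbours-inside  : ∀ {u} → u ∈ A → neighbours G u ≡ ∁ A
      neighbours-outside : ∀ {u} → u ∈ ∁ A → neighbours G u ≡ A

  open IsCompleteBipartition

  ∁-isCompleteBipartition : ∀ {A} → IsCompleteBipartition A → IsCompleteBipartition (∁ A)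
  ∁-isCompleteBipartition {A} bip .neighbours-inside  u∈∁A = trans (neighbours-outside bip u∈∁A) (sym (∁-involutive A))
  ∁-isCompleteBipartition {A} bip .neighbours-outside u∈∁∁A = neighbours-inside bip (subst (_ ∈_) (∁-involutive A) u∈∁∁A)

-- Coefficients of the bipartite polynomial.

binomialSum-at-0 : ∀ n f → (∀ i → f (suc i) ≡ 0) → binomialSum n f ≡ f 0
binomialSum-at-0 zero    f f≡0 = refl
binomialSum-at-0 (suc n) f f≡0 = trans
  (cong₂ _+_ (binomialSum-at-0 n f f≡0) (trans (binomialSum-at-0 n (f ∘ suc) (f≡0 ∘ suc)) (f≡0 0)))
  (ℕₚ.+-identityʳ (f 0))

-- Only the weight `n C 1`, which is `n`, survives: each step of the recursion adds one copy of
-- `f 1`.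
binomialSum-at-1 : ∀ n f → f 0 ≡ 0 → (∀ i → f (suc (suc i)) ≡ 0) → binomialSum n f ≡ n * f 1
binomialSum-at-1 zero    f f0≡0 f≡0 = f0≡0
binomialSum-at-1 (suc n) f f0≡0 f≡0 = trans
  (cong₂ _+_ (binomialSum-at-1 n f f0≡0 f≡0) (binomialSum-at-0 n (f ∘ suc) f≡0))
  (ℕₚ.+-comm (n * f 1) (f 1))

-- The part of `binomialSum n f` with index from 1 to `n`, the range over which the double sum runs.
positiveTerms : ℕ → (ℕ → ℕ) → ℕ
positiveTerms n f = sum (applyUpTo (λ i → (n C suc i) * f (suc i)) n)

binomialSum-positiveTerms : ∀ n f → binomialSum n f ≡ f 0 + positiveTerms n f
binomialSum-positiveTerms n f =
  trans (binomialSum-closed n f) (cong (_+ positiveTerms n f) (ℕₚ.*-identityˡ (f 0)))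

positiveTerms-cong : ∀ n f g → (∀ i → f (suc i) ≡ g (suc i)) → positiveTerms n f ≡ positiveTerms n g
positiveTerms-cong n f g f≡g = sum-applyUpTo-cong n λ i → cong ((n C suc i) *_) (f≡g i)

positiveTerms-+ : ∀ n f g → positiveTerms n (λ i → f i + g i) ≡ positiveTerms n f + positiveTerms n g
positiveTerms-+ n f g = trans
  (sum-applyUpTo-cong n λ i → ℕₚ.*-distribˡ-+ (n C suc i) (f (suc i)) (g (suc i)))
  (sum-applyUpTo-+ n _ _)

sum-applyUpTo-* : ∀ n c (f : ℕ → ℕ) → sum (applyUpTo (λ i → c * f i) n) ≡ c * sum (applyUpTo f n)
sum-applyUpTo-* zero    c f = sym (ℕₚ.*-zeroʳ c)
sum-applyUpTo-* (suc n) c f = trans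
  (cong (c * f 0 +_) (sum-applyUpTo-* n c (f ∘ suc))) (sym (ℕₚ.*-distribˡ-+ c (f 0) _))

-- The contribution to da(K_{n,m}) of a vertex set with i vertices on the side
-- of size n and j vertices on the side of size m.
setTerm : ℕ → ℕ → ℕ → ℕ → Poly
setTerm n m (suc i) (suc j) = monomial 1 (suc i + suc j)
  (ℤ.+ (n + m) ℤ.+ ((ℤ.+ (2 * suc i) ℤ.- ℤ.+ n) ℤ.⊓ (ℤ.+ (2 * suc j) ℤ.- ℤ.+ m)))
setTerm n m 1       0       = monomial 1 1 (ℤ.+ n)
setTerm n m 0       1       = monomial 1 1 (ℤ.+ m)
setTerm n m _       _       = []

mixedPoly : ℕ → ℕ → Poly
mixedPoly n m = monomial 1 0 (ℤ.+ (n + m)) ⊗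
  ∑ [1⋯ n ] λ i → ∑ [1⋯ m ] λ j →
    monomial ((n C i) * (m C j)) (i + j)
             ((ℤ.+ (2 * i) ℤ.- ℤ.+ n) ℤ.⊓ (ℤ.+ (2 * j) ℤ.- ℤ.+ m))

coefficient-shift-∑ : ∀ {A : Set} a b t (xs : List A) f →
  coefficient a b (map t (∑ xs f)) ≡ sum (map (coefficient a b ∘ map t ∘ f) xs)
coefficient-shift-∑ a b t xs f =
  trans (cong (coefficient a b) (map-concatMap t f xs)) (coefficient-∑ a b xs (map t ∘ f))

module _ (n m a : ℕ) (b : ℤ) where

  private
    g : ℕ → ℕ → ℕ
    g i j = coefficient a b (setTerm n m i j)

    shift = multiplyTerms (1 , 0 , ℤ.+ (n + m))

  -- Multiplying by the monomial of exponent `n + m` gives each entry the exponents of `setTerm`,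
  -- with weight `(n C i) * (m C j)`; the factor `n C i` then leaves the inner sum.
  coefficient-mixedPoly : coefficient a b (mixedPoly n m) ≡ positiveTerms n (positiveTerms m ∘ g)
  coefficient-mixedPoly = begin
    -- With a single term as left factor, `_⊗_` computes to `map shift` followed by an empty list.
    coefficient a b (map shift (∑ [1⋯ n ] row) ++ [])
      ≡⟨ cong (coefficient a b) (++-identityʳ (map shift (∑ [1⋯ n ] row))) ⟩
    coefficient a b (map shift (∑ [1⋯ n ] row))
      ≡⟨ coefficient-shift-∑ a b shift [1⋯ n ] row ⟩
    sum (map (coefficient a b ∘ map shift ∘ row) [1⋯ n ])
      ≡⟨ cong sum (map-applyUpTo suc (coefficient a b ∘ map shift ∘ row) n) ⟩
    sum (applyUpTo (coefficient a b ∘ map shift ∘ row ∘ suc) n)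
      ≡⟨ sum-applyUpTo-cong n row-coefficient ⟩
    positiveTerms n (positiveTerms m ∘ g) ∎
    where
    open ≡-Reasoning
    entry : ℕ → ℕ → Poly
    entry i j = monomial ((n C i) * (m C j)) (i + j)
                         ((ℤ.+ (2 * i) ℤ.- ℤ.+ n) ℤ.⊓ (ℤ.+ (2 * j) ℤ.- ℤ.+ m))
    row : ℕ → Poly
    row i = ∑ [1⋯ m ] (entry i)

    entry-coefficient : ∀ i j → coefficient a b (map shift (entry (suc i) (suc j))) ≡
                        (n C suc i) * ((m C suc j) * g (suc i) (suc j))
    entry-coefficient i j = begin
      coefficient a b (map shift (entry (suc i) (suc j)))
        ≡⟨ coefficient-monomial a b (1 * ((n C suc i) * (m C suc j))) (suc i + suc j) _ ⟩
      1 * ((n C suc i) * (m C suc j)) * g (suc i) (suc j)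
        ≡⟨ cong (_* g (suc i) (suc j)) (ℕₚ.*-identityˡ ((n C suc i) * (m C suc j))) ⟩
      (n C suc i) * (m C suc j) * g (suc i) (suc j)
        ≡⟨ ℕₚ.*-assoc (n C suc i) (m C suc j) _ ⟩
      (n C suc i) * ((m C suc j) * g (suc i) (suc j)) ∎

    row-coefficient : ∀ i → coefficient a b (map shift (row (suc i))) ≡
                      (n C suc i) * positiveTerms m (g (suc i))
    row-coefficient i = begin
      coefficient a b (map shift (∑ [1⋯ m ] (entry (suc i))))
        ≡⟨ coefficient-shift-∑ a b shift [1⋯ m ] (entry (suc i)) ⟩
      sum (map (coefficient a b ∘ map shift ∘ entry (suc i)) [1⋯ m ])
        ≡⟨ cong sum (map-applyUpTo suc (coefficient a b ∘ map shift ∘ entry (suc i)) m) ⟩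
      sum (applyUpTo (coefficient a b ∘ map shift ∘ entry (suc i) ∘ suc) m)
        ≡⟨ sum-applyUpTo-cong m (entry-coefficient i) ⟩
      sum (applyUpTo (λ j → (n C suc i) * ((m C suc j) * g (suc i) (suc j))) m)
        ≡⟨ sum-applyUpTo-* m (n C suc i) _ ⟩
      (n C suc i) * positiveTerms m (g (suc i)) ∎

  coefficient-bipartitePoly : coefficient a b (bipartitePoly n m) ≡
                              n * g 1 0 + m * g 0 1 + coefficient a b (mixedPoly n m)
  coefficient-bipartitePoly = begin
    coefficient a b (monomial n 1 (ℤ.+ n) ⊕ monomial m 1 (ℤ.+ m) ⊕ mixedPoly n m)
      ≡⟨ coefficient-++ a b (monomial n 1 (ℤ.+ n) ⊕ monomial m 1 (ℤ.+ m)) (mixedPoly n m) ⟩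
    coefficient a b (monomial n 1 (ℤ.+ n) ⊕ monomial m 1 (ℤ.+ m)) + coefficient a b (mixedPoly n m)
      ≡⟨ cong (_+ coefficient a b (mixedPoly n m)) (trans
           (coefficient-++ a b (monomial n 1 (ℤ.+ n)) (monomial m 1 (ℤ.+ m)))
           (cong₂ _+_ (coefficient-monomial a b n 1 (ℤ.+ n)) (coefficient-monomial a b m 1 (ℤ.+ m)))) ⟩
    n * g 1 0 + m * g 0 1 + coefficient a b (mixedPoly n m) ∎
    where open ≡-Reasoning

  -- The index pairs split into the row `i = 0`, the column `j = 0` and the rest. In the row and the
  -- column only `g 0 1` and `g 1 0` can be nonzero, giving the linear terms; the rest is the double
  -- sum.
  coefficient-by-sides : binomialSum n (binomialSum m ∘ g) ≡ coefficient a b (bipartitePoly n m)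
  coefficient-by-sides = begin
    binomialSum n (binomialSum m ∘ g)
      ≡⟨ binomialSum-positiveTerms n _ ⟩
    binomialSum m (g 0) + positiveTerms n (binomialSum m ∘ g)
      ≡⟨ cong₂ _+_ (binomialSum-at-1 m (g 0) refl λ _ → refl)
                   (positiveTerms-cong n (binomialSum m ∘ g) (λ i → g i 0 + positiveTerms m (g i)) λ i → binomialSum-positiveTerms m (g (suc i))) ⟩
    m * g 0 1 + positiveTerms n (λ i → g i 0 + positiveTerms m (g i))
      ≡⟨ cong (m * g 0 1 +_) (positiveTerms-+ n (λ i → g i 0) (positiveTerms m ∘ g)) ⟩
    m * g 0 1 + (positiveTerms n (λ i → g i 0) + positiveTerms n (positiveTerms m ∘ g))
      -- Since `g 0 0` is zero, the column can be completed to a full binomial sum, to which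
      -- `binomialSum-at-1` applies.
      ≡⟨ cong (λ k → m * g 0 1 + (k + positiveTerms n (positiveTerms m ∘ g)))
              (trans (sym (binomialSum-positiveTerms n (λ i → g i 0)))
                     (binomialSum-at-1 n (λ i → g i 0) refl λ _ → refl)) ⟩
    m * g 0 1 + (n * g 1 0 + positiveTerms n (positiveTerms m ∘ g))
      ≡⟨ ℕₚ.+-assoc (m * g 0 1) (n * g 1 0) _ ⟨
    m * g 0 1 + n * g 1 0 + positiveTerms n (positiveTerms m ∘ g)
      ≡⟨ cong₂ _+_ (ℕₚ.+-comm (m * g 0 1) (n * g 1 0)) (sym coefficient-mixedPoly) ⟩
    n * g 1 0 + m * g 0 1 + coefficient a b (mixedPoly n m)
      ≡⟨ coefficient-bipartitePoly ⟨
    coefficient a b (bipartitePoly n m) ∎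
    where open ≡-Reasoning

-- The alliance polynomial of a complete bipartition.

one-sided-connected⇒∣S∣≤1 : ∀ G {A S} → IsCompleteBipartition G A → S ⊆ A →
                            InducedConnected G S → ∣ S ∣ ≤ 1
one-sided-connected⇒∣S∣≤1 G bip S⊆A = edgeless-connected⇒∣S∣≤1 G λ u∈S v∈S uv →
  x∈∁p⇒x∉p (subst (_ ∈_) (neighbours-inside bip (S⊆A u∈S)) (∈-neighbours⁺ G uv)) (S⊆A v∈S)
  where open IsCompleteBipartition

module _ (G : Graph) {n m} {A : Subset (order G)} (bip : IsCompleteBipartition G A)
         (∣A∣≡n : ∣ A ∣ ≡ n) (∣∁A∣≡m : ∣ ∁ A ∣ ≡ m) where

  open IsCompleteBipartition

  private
    N≡n+m : order G ≡ n + m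
    N≡n+m = trans (sym (∣p∣+∣∁p∣≡n A)) (cong₂ _+_ ∣A∣≡n ∣∁A∣≡m)

    degree-inside : ∀ {u} → u ∈ A → degree G u ≡ m
    degree-inside u∈A = trans (cong ∣_∣ (neighbours-inside bip u∈A)) ∣∁A∣≡m

    degree-outside : ∀ {u} → u ∈ ∁ A → degree G u ≡ n
    degree-outside u∈∁A = trans (cong ∣_∣ (neighbours-outside bip u∈∁A)) ∣A∣≡n

    ∈-cases : ∀ u → u ∈ A ⊎ u ∈ ∁ A
    ∈-cases u with u ∈? A
    ... | yes u∈A = inj₁ u∈A
    ... | no  u∉A = inj₂ (x∉p⇒x∈∁p u∉A)

  -- Vertices on opposite sides are adjacent; two on the same side are joined through a vertex of
  -- `S` on the other side.
  mixed-connected : ∀ {S} → Nonempty (S ∩ A) → Nonempty (S ∩ ∁ A) → InducedConnected G S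
  mixed-connected {S} (x , x∈) (y , y∈) u u∈S v v∈S =
    case (∈-cases u , ∈-cases v) of λ where
      (inj₁ u∈A , inj₁ v∈A) → (u∈S , y∈S , edge u∈A y∈∁A) ◅ (y∈S , v∈S , adj-sym G (edge v∈A y∈∁A)) ◅ ε
      (inj₁ u∈A , inj₂ v∈B) → (u∈S , v∈S , edge u∈A v∈B) ◅ ε
      (inj₂ u∈B , inj₁ v∈A) → (u∈S , v∈S , adj-sym G (edge v∈A u∈B)) ◅ ε
      (inj₂ u∈B , inj₂ v∈B) → (u∈S , x∈S , adj-sym G (edge x∈A u∈B)) ◅ (x∈S , v∈S , edge x∈A v∈B) ◅ ε
    where
    edge : ∀ {w z} → w ∈ A → z ∈ ∁ A → Adj G w z
    edge w∈A z∈∁A = ∈-neighbours⁻ G (subst (_ ∈_) (sym (neighbours-inside bip w∈A)) z∈∁A)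
    x∈S  = proj₁ (x∈p∩q⁻ S A x∈)
    x∈A  = proj₂ (x∈p∩q⁻ S A x∈)
    y∈S  = proj₁ (x∈p∩q⁻ S (∁ A) y∈)
    y∈∁A = proj₂ (x∈p∩q⁻ S (∁ A) y∈)

  -- A singleton has no inner neighbours, so its exponent is the order of `G` minus the degree `q`.
  -- Keeping `p` and `q` general serves both sides.
  singleton-f-y : ∀ {S p q} → ∣ S ∣ ≡ 1 → (∀ {u} → u ∈ S → degree G u ≡ q) → n + m ≡ p + q →
                  ∀ S≢∅ → f-y G S S≢∅ ≡ ℤ.+ p
  singleton-f-y {S} {p} {q} ∣S∣≡1 degree≡q n+m≡p+q S≢∅ with ∣p∣≡1⇒p≡⁅x⁆ S ∣S∣≡1
  ... | x , refl = begin
    f-y G S S≢∅                         ≡⟨ clique-f-y G (⁅⁆-clique G x) ∣S∣≡1 degree≡q S≢∅ ⟩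
    ℤ.+ 0 ℤ.- ℤ.+ q ℤ.+ ℤ.+ order G     ≡⟨ cong (λ k → ℤ.+ 0 ℤ.- ℤ.+ q ℤ.+ ℤ.+ k) (trans N≡n+m n+m≡p+q) ⟩
    ℤ.+ 0 ℤ.- ℤ.+ q ℤ.+ (ℤ.+ p ℤ.+ ℤ.+ q) ≡⟨ solve 2 (λ p q → con (ℤ.+ 0) :- q :+ (p :+ q) := p) refl (ℤ.+ p) (ℤ.+ q) ⟩
    ℤ.+ p                               ∎
    where
    open ≡-Reasoning
    open +-*-Solver

  -- A vertex of `A` has `j` neighbours in `S` and degree `m`; a vertex of `∁ A` has `i` and degree
  -- `n`. As `S` meets both sides, both margins occur and the smaller one is attained.
  mixed-f-y : ∀ {S i j} → ∣ S ∩ A ∣ ≡ i → ∣ S ∩ ∁ A ∣ ≡ j → Nonempty (S ∩ A) → Nonempty (S ∩ ∁ A) →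
    ∀ S≢∅ → f-y G S S≢∅ ≡ ℤ.+ (n + m) ℤ.+ ((ℤ.+ (2 * i) ℤ.- ℤ.+ n) ℤ.⊓ (ℤ.+ (2 * j) ℤ.- ℤ.+ m))
  mixed-f-y {S} {i} {j} ∣S∩A∣≡i ∣S∩∁A∣≡j (x , x∈) (y , y∈) S≢∅ = f-y-unique G S≢∅ lower attained
    where
    α β : ℤ
    α = ℤ.+ (2 * i) ℤ.- ℤ.+ n
    β = ℤ.+ (2 * j) ℤ.- ℤ.+ m

    margin-inside : ∀ {u} → u ∈ A → margin G S u ≡ ℤ.+ (n + m) ℤ.+ β
    margin-inside {u} u∈A = trans
      (margin-degree G {S} {u} (trans (cong (λ p → ∣ S ∩ p ∣) (neighbours-inside bip u∈A)) ∣S∩∁A∣≡j) (degree-inside u∈A))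
      (trans (cong (λ k → β ℤ.+ ℤ.+ k) N≡n+m) (ℤₚ.+-comm β _))

    margin-outside : ∀ {u} → u ∈ ∁ A → margin G S u ≡ ℤ.+ (n + m) ℤ.+ α
    margin-outside {u} u∈∁A = trans
      (margin-degree G {S} {u} (trans (cong (λ p → ∣ S ∩ p ∣) (neighbours-outside bip u∈∁A)) ∣S∩A∣≡i) (degree-outside u∈∁A))
      (trans (cong (λ k → α ℤ.+ ℤ.+ k) N≡n+m) (ℤₚ.+-comm α _))

    lower : ∀ {u} → u ∈ S → ℤ.+ (n + m) ℤ.+ (α ℤ.⊓ β) ℤ.≤ margin G S u
    lower {u} _ with ∈-cases u
    ... | inj₁ u∈A  = subst (_ ℤ.≤_) (sym (margin-inside u∈A)) (ℤₚ.+-monoʳ-≤ (ℤ.+ (n + m)) (ℤₚ.i⊓j≤j α β))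
    ... | inj₂ u∈∁A = subst (_ ℤ.≤_) (sym (margin-outside u∈∁A)) (ℤₚ.+-monoʳ-≤ (ℤ.+ (n + m)) (ℤₚ.i⊓j≤i α β))

    attained : ∃ λ u → u ∈ S × margin G S u ≡ ℤ.+ (n + m) ℤ.+ (α ℤ.⊓ β)
    attained with ℤₚ.⊓-sel α β | x∈p∩q⁻ S A x∈ | x∈p∩q⁻ S (∁ A) y∈
    ... | inj₁ ≡α | _         | y∈S , y∈∁A = y , y∈S , trans (margin-outside y∈∁A) (cong (λ k → ℤ.+ (n + m) ℤ.+ k) (sym ≡α))
    ... | inj₂ ≡β | x∈S , x∈A | _          = x , x∈S , trans (margin-inside x∈A) (cong (λ k → ℤ.+ (n + m) ℤ.+ k) (sym ≡β))

  -- The two counts decide validity: a singleton or a set meeting both sides is connected, a larger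
  -- one-sided set is not. The decision `d` is a parameter so that it can be matched, and each
  -- impossible answer is refuted.
  summand-by-sides : ∀ S d → summand G S d ≡ setTerm n m ∣ S ∩ A ∣ ∣ S ∩ ∁ A ∣
  summand-by-sides S d = by-sides ∣ S ∩ A ∣ ∣ S ∩ ∁ A ∣ refl refl d
    where
    ∣S∣≡ : ∀ {i j} → ∣ S ∩ A ∣ ≡ i → ∣ S ∩ ∁ A ∣ ≡ j → ∣ S ∣ ≡ i + j
    ∣S∣≡ refl refl = sym (∣p∩q∣+∣p∩∁q∣≡∣p∣ S A)

    ⊆-side : ∀ {B} → ∣ S ∩ ∁ B ∣ ≡ 0 → S ⊆ B
    ⊆-side {B} ≡0 {x} x∈S = x∉∁p⇒x∈p λ x∈∁B →
      ∉⊥ (subst (x ∈_) (∣p∣≡0⇒p≡⊥ (S ∩ ∁ B) ≡0) (x∈p∩q⁺ (x∈S , x∈∁B)))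

    nonempty : ∀ {k} (p : Subset (order G)) → ∣ p ∣ ≡ suc k → Nonempty p
    nonempty p ∣p∣≡1+k = 0<∣p∣⇒Nonempty p (subst (0 <_) (sym ∣p∣≡1+k) ℕₚ.0<1+n)

    singleton-connected : ∣ S ∣ ≡ 1 → Nonempty S × InducedConnected G S
    singleton-connected ∣S∣≡1 with ∣p∣≡1⇒p≡⁅x⁆ S ∣S∣≡1
    ... | x , refl = (x , x∈⁅x⁆ x) , clique-connected G (⁅⁆-clique G x)

    by-sides : ∀ i j → ∣ S ∩ A ∣ ≡ i → ∣ S ∩ ∁ A ∣ ≡ j → ∀ d → summand G S d ≡ setTerm n m i j
    by-sides 0 0 ∣S∩A∣≡ ∣S∩B∣≡ (yes ((x , x∈S) , _)) =
      contradiction (subst (x ∈_) (∣p∣≡0⇒p≡⊥ S (∣S∣≡ ∣S∩A∣≡ ∣S∩B∣≡)) x∈S) ∉⊥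
    by-sides 0 0 _ _ (no _) = refl
    by-sides 1 0 ∣S∩A∣≡ ∣S∩B∣≡ (yes (S≢∅ , _)) = cong₂ (monomial 1) (∣S∣≡ ∣S∩A∣≡ ∣S∩B∣≡)
      (singleton-f-y (∣S∣≡ ∣S∩A∣≡ ∣S∩B∣≡) (degree-inside ∘ ⊆-side ∣S∩B∣≡) refl S≢∅)
    by-sides 1 0 ∣S∩A∣≡ ∣S∩B∣≡ (no ¬valid) = contradiction (singleton-connected (∣S∣≡ ∣S∩A∣≡ ∣S∩B∣≡)) ¬valid
    by-sides 0 1 ∣S∩A∣≡ ∣S∩B∣≡ (yes (S≢∅ , _)) = cong₂ (monomial 1) (∣S∣≡ ∣S∩A∣≡ ∣S∩B∣≡)
      (singleton-f-y (∣S∣≡ ∣S∩A∣≡ ∣S∩B∣≡) (degree-outside ∘ ⊆-side ∣S∩∁∁A∣≡0) (ℕₚ.+-comm n m) S≢∅)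
      where ∣S∩∁∁A∣≡0 = trans (cong (λ p → ∣ S ∩ p ∣) (∁-involutive A)) ∣S∩A∣≡
    by-sides 0 1 ∣S∩A∣≡ ∣S∩B∣≡ (no ¬valid) = contradiction (singleton-connected (∣S∣≡ ∣S∩A∣≡ ∣S∩B∣≡)) ¬valid
    by-sides (suc i) (suc j) ∣S∩A∣≡ ∣S∩B∣≡ (yes (S≢∅ , _)) = cong₂ (monomial 1) (∣S∣≡ ∣S∩A∣≡ ∣S∩B∣≡)
      (mixed-f-y ∣S∩A∣≡ ∣S∩B∣≡ (nonempty (S ∩ A) ∣S∩A∣≡) (nonempty (S ∩ ∁ A) ∣S∩B∣≡) S≢∅)
    by-sides (suc i) (suc j) ∣S∩A∣≡ ∣S∩B∣≡ (no ¬valid) = contradiction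
      ((proj₁ x , proj₁ (x∈p∩q⁻ S A (proj₂ x))) , mixed-connected x (nonempty (S ∩ ∁ A) ∣S∩B∣≡)) ¬valid
      where x = nonempty (S ∩ A) ∣S∩A∣≡
    by-sides (suc (suc i)) 0 ∣S∩A∣≡ ∣S∩B∣≡ (yes (_ , connected)) = contradiction
      (subst (_≤ 1) (∣S∣≡ ∣S∩A∣≡ ∣S∩B∣≡) (one-sided-connected⇒∣S∣≤1 G bip (⊆-side ∣S∩B∣≡) connected)) λ { (s≤s ()) }
    by-sides (suc (suc i)) 0 _ _ (no _) = refl
    by-sides 0 (suc (suc j)) ∣S∩A∣≡ ∣S∩B∣≡ (yes (_ , connected)) = contradiction
      (subst (_≤ 1) (∣S∣≡ ∣S∩A∣≡ ∣S∩B∣≡)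
        (one-sided-connected⇒∣S∣≤1 G (∁-isCompleteBipartition G bip) (⊆-side ∣S∩∁∁A∣≡0) connected)) λ { (s≤s ()) }
      where ∣S∩∁∁A∣≡0 = trans (cong (λ p → ∣ S ∩ p ∣) (∁-involutive A)) ∣S∩A∣≡
    by-sides 0 (suc (suc j)) _ _ (no _) = refl

  bipartition⇒da≈ : da G ≈ bipartitePoly n m
  bipartition⇒da≈ a b = begin
    coefficient a b (da G)
      ≡⟨ coefficient-∑ a b (subsets (order G)) _ ⟩
    sum (map (λ S → coefficient a b (summand G S (nonempty? S ×-dec inducedConnected? G S))) (subsets (order G)))
      ≡⟨ cong sum (map-cong (λ S → cong (coefficient a b) (summand-by-sides S (nonempty? S ×-dec inducedConnected? G S))) (subsets (order G))) ⟩
    sum (map (λ S → coefficient a b (setTerm n m ∣ S ∩ A ∣ ∣ S ∩ ∁ A ∣)) (subsets (order G)))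
      ≡⟨ sum-subsets-split A (λ i j → coefficient a b (setTerm n m i j)) ⟩
    binomialSum ∣ A ∣ (λ i → binomialSum ∣ ∁ A ∣ (λ j → coefficient a b (setTerm n m i j)))
      ≡⟨ cong₂ (λ k l → binomialSum k (λ i → binomialSum l (λ j → coefficient a b (setTerm n m i j)))) ∣A∣≡n ∣∁A∣≡m ⟩
    binomialSum n (λ i → binomialSum m (λ j → coefficient a b (setTerm n m i j)))
      ≡⟨ coefficient-by-sides n m a b ⟩
    coefficient a b (bipartitePoly n m) ∎
    where open ≡-Reasoning

-- Support and linear terms of the bipartite polynomial.

sum-applyUpTo≢0 : ∀ n f → sum (applyUpTo f n) ≢ 0 → ∃ λ i → f i ≢ 0
sum-applyUpTo≢0 zero    f ≢0 = contradiction refl ≢0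
sum-applyUpTo≢0 (suc n) f ≢0 with f 0 ℕₚ.≟ 0
... | no f0≢0  = 0 , f0≢0
... | yes f0≡0 with sum-applyUpTo≢0 n (f ∘ suc) (≢0 ∘ cong₂ _+_ f0≡0)
...   | i , fi≢0 = suc i , fi≢0

positiveTerms≢0 : ∀ n f → positiveTerms n f ≢ 0 → ∃ λ i → f (suc i) ≢ 0
positiveTerms≢0 n f ≢0 with sum-applyUpTo≢0 n _ ≢0
... | i , Cf≢0 = i , λ f≡0 → Cf≢0 (trans (cong ((n C suc i) *_) f≡0) (ℕₚ.*-zeroʳ (n C suc i)))

-- A nonzero sum has a nonzero term, and each term here is one monomial, whose exponents can be read
-- off.
mixedPoly-support : ∀ {n m a b} → coefficient a b (mixedPoly n m) ≢ 0 → ∃ λ i → ∃ λ j →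
  a ≡ suc i + suc j ×
  b ≡ ℤ.+ (n + m) ℤ.+ ((ℤ.+ (2 * suc i) ℤ.- ℤ.+ n) ℤ.⊓ (ℤ.+ (2 * suc j) ℤ.- ℤ.+ m))
mixedPoly-support {n} {m} {a} {b} ≢0
  with i , row≢0 ← positiveTerms≢0 n (λ i → positiveTerms m (λ j → coefficient a b (setTerm n m i j))) (≢0 ∘ trans (coefficient-mixedPoly n m a b))
  with j , term≢0 ← positiveTerms≢0 m (λ j → coefficient a b (setTerm n m (suc i) j)) row≢0
  with coefficient≢0⇒∈ {a} {b} (setTerm n m (suc i) (suc j)) term≢0
... | _ , here refl = i , j , refl , refl

-- In `x`-degree at least 2 the two linear summands have coefficient zero.
bipartitePoly-support : ∀ {n m a b} → coefficient (2 + a) b (bipartitePoly n m) ≢ 0 → ∃ λ i → ∃ λ j →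
  2 + a ≡ suc i + suc j ×
  b ≡ ℤ.+ (n + m) ℤ.+ ((ℤ.+ (2 * suc i) ℤ.- ℤ.+ n) ℤ.⊓ (ℤ.+ (2 * suc j) ℤ.- ℤ.+ m))
bipartitePoly-support {n} {m} {a} {b} ≢0 = mixedPoly-support {n} {m} λ ≡0 → ≢0 (trans
  (coefficient-bipartitePoly n m (2 + a) b) (cong₂ _+_ (cong₂ _+_ (ℕₚ.*-zeroʳ n) (ℕₚ.*-zeroʳ m)) ≡0))

coefficient-linear : ∀ b c → coefficient 1 b (monomial 1 1 c) ≡ indicator (does (c ℤ.≟ b))
coefficient-linear b c with does (c ℤ.≟ b)
... | true  = refl
... | false = refl

-- The double sum contributes nothing, since its `x`-exponents `suc i + suc j` are at least 2.
bipartitePoly-linear : ∀ n m b → coefficient 1 b (bipartitePoly n m) ≡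
  n * indicator (does (ℤ.+ n ℤ.≟ b)) + m * indicator (does (ℤ.+ m ℤ.≟ b))
bipartitePoly-linear n m b = begin
  coefficient 1 b (bipartitePoly n m)
    ≡⟨ coefficient-bipartitePoly n m 1 b ⟩
  n * coefficient 1 b (monomial 1 1 (ℤ.+ n)) + m * coefficient 1 b (monomial 1 1 (ℤ.+ m))
    + coefficient 1 b (mixedPoly n m)
    ≡⟨ cong₂ _+_ (cong₂ (λ x y → n * x + m * y) (coefficient-linear b (ℤ.+ n)) (coefficient-linear b (ℤ.+ m)))
                 mixed≡0 ⟩
  n * indicator (does (ℤ.+ n ℤ.≟ b)) + m * indicator (does (ℤ.+ m ℤ.≟ b)) + 0
    ≡⟨ ℕₚ.+-identityʳ _ ⟩
  n * indicator (does (ℤ.+ n ℤ.≟ b)) + m * indicator (does (ℤ.+ m ℤ.≟ b)) ∎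
  where
  open ≡-Reasoning
  mixed≡0 : coefficient 1 b (mixedPoly n m) ≡ 0
  mixed≡0 = decidable-stable (_ ℕₚ.≟ 0) λ ≢0 → case mixedPoly-support {n} {m} ≢0 of λ where
    (i , j , 1≡ , _) → ℕₚ.0≢1+n (trans (ℕₚ.suc-injective 1≡) (ℕₚ.+-suc i j))

-- Degree classes and criteria for a complete bipartition.

module _ (G : Graph) where

  private
    N = order G

  -- The exponent of `y` in the term of `⁅ u ⁆`, in the form that `clique-f-y` yields for a
  -- one-vertex clique.
  singletonExponent : Vertex G → ℤ
  singletonExponent u = ℤ.+ 0 ℤ.- ℤ.+ degree G u ℤ.+ ℤ.+ N

  -- Vertices are grouped by exponent rather than by degree because the order of `G` is yet to be
  -- derived; only once it is known to be `n + m` does exponent `n` mean degree `m`.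
  exponentClass : ℤ → Subset N
  exponentClass b = tabulate λ u → does (singletonExponent u ℤ.≟ b)

  ∈-exponentClass⁺ : ∀ b {u} → singletonExponent u ≡ b → u ∈ exponentClass b
  ∈-exponentClass⁺ b {u} ≡b = ∈-tabulate⁺ (dec-true (singletonExponent u ℤ.≟ b) ≡b)

  ∈-exponentClass⁻ : ∀ b {u} → u ∈ exponentClass b → singletonExponent u ≡ b
  ∈-exponentClass⁻ b {u} u∈ with singletonExponent u ℤ.≟ b | ∈-tabulate⁻ {f = λ v → does (singletonExponent v ℤ.≟ b)} u∈
  ... | yes ≡b | _  = ≡b
  ... | no _   | ()

  -- Only singletons contribute in `x`-degree 1, and every singleton is connected, so the
  -- coefficient counts vertices by exponent.
  coefficient-1-da : ∀ b → coefficient 1 b (da G) ≡ ∣ exponentClass b ∣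
  coefficient-1-da b = begin
    coefficient 1 b (da G)                     ≡⟨ coefficient-∑ 1 b (subsets N) _ ⟩
    sum (map F (subsets N))                    ≡⟨ sum-singletons F (λ S → other S (valid? S)) ⟩
    ∑ᶠ (F ∘ ⁅_⁆)                               ≡⟨ sum-cong-≗ (λ u → singleton u (valid? ⁅ u ⁆)) ⟩
    ∑ᶠ (λ u → indicator (does (singletonExponent u ℤ.≟ b))) ≡⟨ ∣tabulate∣ (λ u → does (singletonExponent u ℤ.≟ b)) ⟨
    ∣ exponentClass b ∣                        ∎
    where
    open ≡-Reasoning
    valid? : ∀ S → Dec (Nonempty S × InducedConnected G S)
    valid? S = nonempty? S ×-dec inducedConnected? G S

    F : Subset N → ℕ
    F S = coefficient 1 b (summand G S (valid? S))

    other : ∀ S d → ∣ S ∣ ≢ 1 → coefficient 1 b (summand G S d) ≡ 0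
    other S (yes _) ∣S∣≢1 = coefficient-there _ [] (∣S∣≢1 ∘ cong proj₁)
    other S (no _)  _     = refl

    singleton : ∀ u d → coefficient 1 b (summand G ⁅ u ⁆ d) ≡ indicator (does (singletonExponent u ℤ.≟ b))
    singleton u (yes (S≢∅ , _)) = trans
      (cong₂ (λ a c → coefficient 1 b (monomial 1 a c)) (∣⁅x⁆∣≡1 u)
        (clique-f-y G (⁅⁆-clique G u) (∣⁅x⁆∣≡1 u) (λ v∈ → cong (degree G) (x∈⁅y⁆⇒x≡y u v∈)) S≢∅))
      (coefficient-linear b (singletonExponent u))
    singleton u (no ¬valid) = contradiction ((u , x∈⁅x⁆ u) , clique-connected G (⁅⁆-clique G u)) ¬valid

  -- A vertex of the independent side `∁ A` has all its neighbours in `A`, and as many as `A` has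
  -- elements, so it is joined to all of `A`. By symmetry a vertex of `A` is joined to all of `∁ A`,
  -- and its degree leaves room for no other neighbour.
  independent-side⇒bipartition : ∀ {p q} {A : Subset N} →
    (∀ {u} → u ∈ A → degree G u ≡ p) → (∀ {u} → u ∈ ∁ A → degree G u ≡ q) →
    ∣ A ∣ ≡ q → ∣ ∁ A ∣ ≡ p → (∀ {u v} → u ∈ ∁ A → v ∈ ∁ A → ¬ Adj G u v) →
    IsCompleteBipartition G A
  independent-side⇒bipartition {p} {q} {A} degree-A degree-∁A ∣A∣≡q ∣∁A∣≡p independent = record
    { neighbours-inside = λ {u} u∈A → sym (p⊆q∧∣q∣≤∣p∣⇒p≡q
        (λ {v} v∈∁A → neighbours-sym G (subst (u ∈_) (sym (outside≡ v∈∁A)) u∈A))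
        (ℕₚ.≤-reflexive (trans (degree-A u∈A) (sym ∣∁A∣≡p))))
    ; neighbours-outside = outside≡
    }
    where
    outside≡ : ∀ {v} → v ∈ ∁ A → neighbours G v ≡ A
    outside≡ v∈∁A = p⊆q∧∣q∣≤∣p∣⇒p≡q
      (λ w∈ → x∉∁p⇒x∈p λ w∈∁A → independent v∈∁A w∈∁A (∈-neighbours⁻ G w∈))
      (ℕₚ.≤-reflexive (trans ∣A∣≡q (sym (degree-∁A v∈∁A))))

  -- For `w` in `neighbours G u`, triangle-freeness puts the `d` neighbours of `w` into the
  -- complement, which has `d` elements as well.
  triangle-free⇒bipartition : ∀ {d} → (∀ u → degree G u ≡ d) → N ≡ d + d →
    (∀ {u v w} → Adj G u v → Adj G u w → ¬ Adj G v w) →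
    ∀ {u v} → Adj G u v → IsCompleteBipartition G (neighbours G u)
  triangle-free⇒bipartition {d} regular N≡d+d triangle-free {u} {v} uv = record
    { neighbours-inside  = inside≡
    ; neighbours-outside = λ {w} w∈∁ → p⊆q∧∣q∣≤∣p∣⇒p≡q
        (λ x∈ → x∉∁p⇒x∈p λ x∈∁ → triangle-free (∁⇒Adj-v w∈∁) (∁⇒Adj-v x∈∁) (∈-neighbours⁻ G x∈))
        (ℕₚ.≤-reflexive (trans (regular u) (sym (regular w))))
    }
    where
    ∣∁∣≡d : ∣ ∁ (neighbours G u) ∣ ≡ d
    ∣∁∣≡d = ℕₚ.+-cancelˡ-≡ d _ _
      (trans (cong (_+ ∣ ∁ (neighbours G u) ∣) (sym (regular u))) (trans (∣p∣+∣∁p∣≡n (neighbours G u)) N≡d+d))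

    inside≡ : ∀ {w} → w ∈ neighbours G u → neighbours G w ≡ ∁ (neighbours G u)
    inside≡ {w} w∈ = p⊆q∧∣q∣≤∣p∣⇒p≡q
      (λ x∈ → x∉p⇒x∈∁p λ x∈Nu → triangle-free (∈-neighbours⁻ G w∈) (∈-neighbours⁻ G x∈Nu) (∈-neighbours⁻ G x∈))
      (ℕₚ.≤-reflexive (trans ∣∁∣≡d (sym (regular w))))

    -- The case `w = v` of `inside≡`. As the complement consists of neighbours of `v`,
    -- triangle-freeness makes it independent.
    ∁⇒Adj-v : ∀ {w} → w ∈ ∁ (neighbours G u) → Adj G v w
    ∁⇒Adj-v w∈∁ = ∈-neighbours⁻ G (subst (_ ∈_) (sym (inside≡ (∈-neighbours⁺ G uv))) w∈∁)

-- From the polynomial to a complete bipartition.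

indicator-yes : ∀ {b c : ℤ} → c ≡ b → indicator (does (c ℤ.≟ b)) ≡ 1
indicator-yes {b} {c} c≡b = cong indicator (dec-true (c ℤ.≟ b) c≡b)

indicator-no : ∀ {b c : ℤ} → c ≢ b → indicator (does (c ℤ.≟ b)) ≡ 0
indicator-no {b} {c} c≢b = cong indicator (dec-false (c ℤ.≟ b) c≢b)

-‿≤⇒+≤+ : ∀ {a d x n} → ℤ.+ a ℤ.- ℤ.+ d ℤ.≤ ℤ.+ x ℤ.- ℤ.+ n → a + n ≤ x + d
-‿≤⇒+≤+ {a} {d} {x} {n} ≤ = ℤₚ.drop‿+≤+ (subst₂ ℤ._≤_
  (solve 3 (λ a d n → a :- d :+ (d :+ n) := a :+ n) refl (ℤ.+ a) (ℤ.+ d) (ℤ.+ n))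
  (solve 3 (λ x d n → x :- n :+ (d :+ n) := x :+ d) refl (ℤ.+ x) (ℤ.+ d) (ℤ.+ n))
  (ℤₚ.+-monoˡ-≤ (ℤ.+ d ℤ.+ ℤ.+ n) ≤))
  where open +-*-Solver

exponent⇒degree : ∀ G {u p q} → order G ≡ p + q → singletonExponent G u ≡ ℤ.+ p → degree G u ≡ q
exponent⇒degree G {u} {p} {q} N≡p+q exponent≡p = ℕₚ.+-cancelˡ-≡ p _ _ (ℤₚ.+-injective (begin
  ℤ.+ p ℤ.+ ℤ.+ d                               ≡⟨ cong (ℤ._+ ℤ.+ d) exponent≡p ⟨
  ℤ.+ 0 ℤ.- ℤ.+ d ℤ.+ ℤ.+ order G ℤ.+ ℤ.+ d
    ≡⟨ solve 2 (λ d n → con (ℤ.+ 0) :- d :+ n :+ d := n) refl (ℤ.+ d) (ℤ.+ order G) ⟩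
  ℤ.+ order G                                   ≡⟨ cong (ℤ.+_) N≡p+q ⟩
  ℤ.+ (p + q)                                   ∎))
  where
  open ≡-Reasoning
  open +-*-Solver
  d = degree G u

module _ {n m : ℕ} (G : Graph) (da≈ : da G ≈ bipartitePoly n m) where

  private
    N = order G
    classN = exponentClass G (ℤ.+ n)
    classM = exponentClass G (ℤ.+ m)

  exponentClass-size : ∀ b → ∣ exponentClass G b ∣ ≡
    n * indicator (does (ℤ.+ n ℤ.≟ b)) + m * indicator (does (ℤ.+ m ℤ.≟ b))
  exponentClass-size b = trans (sym (coefficient-1-da G b)) (trans (da≈ 1 b) (bipartitePoly-linear n m b))

  -- A vertex with a third exponent would lie in a class of size zero.
  exponent-cases : ∀ u → singletonExponent G u ≡ ℤ.+ n ⊎ singletonExponent G u ≡ ℤ.+ m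
  exponent-cases u with ℤ.+ n ℤ.≟ singletonExponent G u | ℤ.+ m ℤ.≟ singletonExponent G u
  ... | yes n≡ | _      = inj₁ (sym n≡)
  ... | no _   | yes m≡ = inj₂ (sym m≡)
  ... | no n≢  | no m≢  = contradiction (subst (u ∈_) (∣p∣≡0⇒p≡⊥ _ empty) (∈-exponentClass⁺ G (singletonExponent G u) refl)) ∉⊥
    where
    empty : ∣ exponentClass G (singletonExponent G u) ∣ ≡ 0
    empty = trans (exponentClass-size _) (cong₂ _+_
      (trans (cong (n *_) (indicator-no n≢)) (ℕₚ.*-zeroʳ n))
      (trans (cong (m *_) (indicator-no m≢)) (ℕₚ.*-zeroʳ m)))

  -- The term of the clique must occur in the double sum, at side counts `suc i` and `suc j`. After
  -- cancelling the order, its exponent is a minimum and hence at most each of the two arguments;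
  -- clearing subtractions gives the bounds.
  clique-degree-bounds : ∀ {S k d} → N ≡ n + m → Clique G S → ∣ S ∣ ≡ 2 + k →
    (∀ {u} → u ∈ S → degree G u ≡ d) → ∃ λ i → ∃ λ j → k ≡ i + j ×
    2 * suc k + n ≤ 2 * suc i + d × 2 * suc k + m ≤ 2 * suc j + d
  clique-degree-bounds {S} {k} {d} N≡n+m clique ∣S∣≡2+k degree≡d =
    case bipartitePoly-support {n} {m} {k} exponent-occurs of λ where
      (i , j , 2+k≡ , exponent≡) → i , j , ℕₚ.suc-injective (trans (ℕₚ.suc-injective 2+k≡) (ℕₚ.+-suc i j)) ,
        below i (ℤₚ.i⊓j≤i (α i) (β j)) (reduced i j exponent≡) ,
        below j (ℤₚ.i⊓j≤j (α i) (β j)) (reduced i j exponent≡)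
    where
    value : ℤ
    value = ℤ.+ (2 * suc k) ℤ.- ℤ.+ d

    α β : ℕ → ℤ
    α i = ℤ.+ (2 * suc i) ℤ.- ℤ.+ n
    β j = ℤ.+ (2 * suc j) ℤ.- ℤ.+ m

    exponent-occurs : coefficient (2 + k) (value ℤ.+ ℤ.+ N) (bipartitePoly n m) ≢ 0
    exponent-occurs ≡0 = connected⇒coefficient≢0 G
      (0<∣p∣⇒Nonempty S (subst (0 <_) (sym ∣S∣≡2+k) ℕₚ.0<1+n))
      (clique-connected G clique) ∣S∣≡2+k (clique-f-y G clique ∣S∣≡2+k degree≡d)
      (trans (da≈ (2 + k) (value ℤ.+ ℤ.+ N)) ≡0)

    reduced : ∀ i j → value ℤ.+ ℤ.+ N ≡ ℤ.+ (n + m) ℤ.+ (α i ℤ.⊓ β j) → value ≡ α i ℤ.⊓ β j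
    reduced i j exponent≡ = ℤ-∙-cancelˡ (ℤ.+ (n + m)) _ _ (trans (ℤₚ.+-comm (ℤ.+ (n + m)) value)
      (trans (cong (λ l → value ℤ.+ ℤ.+ l) (sym N≡n+m)) exponent≡))

    below : ∀ i {c γ} → γ ℤ.≤ ℤ.+ (2 * suc i) ℤ.- ℤ.+ c → value ≡ γ → 2 * suc k + c ≤ 2 * suc i + d
    below i γ≤ refl = -‿≤⇒+≤+ {2 * suc k} {d} {2 * suc i} γ≤

  -- For a clique of two vertices both side counts are 1, so the bounds read `2 + n ≤ 2 + d` and
  -- `2 + m ≤ 2 + d`.
  edge-degree-bounds : ∀ {u v d} → N ≡ n + m → degree G u ≡ d → degree G v ≡ d → Adj G u v → n ≤ d × m ≤ d
  edge-degree-bounds {u} {v} {d} N≡n+m degree-u degree-v uv =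
    case clique-degree-bounds N≡n+m clique size degrees of λ where
      (0 , 0 , _ , n≤ , m≤) → ℕₚ.+-cancelˡ-≤ 2 n d n≤ , ℕₚ.+-cancelˡ-≤ 2 m d m≤
    where
    S = ⁅ u ⁆ ∪ ⁅ v ⁆
    clique : Clique G S
    clique = ∪-clique G (λ w∈ → subst (Adj G u) (sym (x∈⁅y⁆⇒x≡y v w∈)) uv) (⁅⁆-clique G v)
    size : ∣ S ∣ ≡ 2
    size = trans (∣⁅x⁆∪p∣≡1+∣p∣ {x = u} {⁅ v ⁆} (x≢y⇒x∉⁅y⁆ λ { refl → adj-irrefl G uv })) (cong suc (∣⁅x⁆∣≡1 v))
    degrees : ∀ {w} → w ∈ S → degree G w ≡ d
    degrees w∈ with x∈p∪q⁻ ⁅ u ⁆ ⁅ v ⁆ w∈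
    ... | inj₁ w∈u = trans (cong (degree G) (x∈⁅y⁆⇒x≡y u w∈u)) degree-u
    ... | inj₂ w∈v = trans (cong (degree G) (x∈⁅y⁆⇒x≡y v w∈v)) degree-v

  -- The exponents `n` and `m` now give complementary classes of `n` and `m` vertices. Their sizes
  -- yield the order of `G`, and from it the degrees: `m` on `classN` and `n` on `classM`.
  da≈⇒bipartition-≢ : n ≢ m → ∃ λ A → IsCompleteBipartition G A × ∣ A ∣ ≡ n × ∣ ∁ A ∣ ≡ m
  da≈⇒bipartition-≢ n≢m = classN , bipartition (ℕₚ.<-cmp n m) , ∣N∣≡n , ∣∁N∣≡m
    where
    ∁N≡M : ∁ classN ≡ classM
    ∁N≡M = ⊆-antisym
      (λ {u} u∈ → case exponent-cases u of λ where
        (inj₁ ≡n) → contradiction (∈-exponentClass⁺ G (ℤ.+ n) ≡n) (x∈∁p⇒x∉p u∈)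
        (inj₂ ≡m) → ∈-exponentClass⁺ G (ℤ.+ m) ≡m)
      (λ u∈M → x∉p⇒x∈∁p λ u∈N → n≢m (ℤₚ.+-injective
        (trans (sym (∈-exponentClass⁻ G (ℤ.+ n) u∈N)) (∈-exponentClass⁻ G (ℤ.+ m) u∈M))))

    ∁M≡N : ∁ classM ≡ classN
    ∁M≡N = trans (cong ∁ (sym ∁N≡M)) (∁-involutive classN)

    ∣N∣≡n : ∣ classN ∣ ≡ n
    ∣N∣≡n = begin
      ∣ classN ∣     ≡⟨ exponentClass-size (ℤ.+ n) ⟩
      _              ≡⟨ cong₂ (λ x y → n * x + m * y) (indicator-yes {ℤ.+ n} refl)
                              (indicator-no (n≢m ∘ sym ∘ ℤₚ.+-injective)) ⟩
      n * 1 + m * 0  ≡⟨ cong₂ _+_ (ℕₚ.*-identityʳ n) (ℕₚ.*-zeroʳ m) ⟩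
      n + 0          ≡⟨ ℕₚ.+-identityʳ n ⟩
      n              ∎
      where open ≡-Reasoning

    ∣M∣≡m : ∣ classM ∣ ≡ m
    ∣M∣≡m = begin
      ∣ classM ∣     ≡⟨ exponentClass-size (ℤ.+ m) ⟩
      _              ≡⟨ cong₂ (λ x y → n * x + m * y) (indicator-no (n≢m ∘ ℤₚ.+-injective))
                              (indicator-yes {ℤ.+ m} refl) ⟩
      n * 0 + m * 1  ≡⟨ cong₂ _+_ (ℕₚ.*-zeroʳ n) (ℕₚ.*-identityʳ m) ⟩
      m              ∎
      where open ≡-Reasoning

    ∣∁N∣≡m : ∣ ∁ classN ∣ ≡ m
    ∣∁N∣≡m = trans (cong ∣_∣ ∁N≡M) ∣M∣≡m

    N≡n+m : N ≡ n + m
    N≡n+m = trans (sym (∣p∣+∣∁p∣≡n classN)) (cong₂ _+_ ∣N∣≡n ∣∁N∣≡m)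

    degree-N : ∀ {u} → u ∈ classN → degree G u ≡ m
    degree-N = exponent⇒degree G N≡n+m ∘ ∈-exponentClass⁻ G (ℤ.+ n)

    degree-M : ∀ {u} → u ∈ classM → degree G u ≡ n
    degree-M = exponent⇒degree G (trans N≡n+m (ℕₚ.+-comm n m)) ∘ ∈-exponentClass⁻ G (ℤ.+ m)

    degree-∁N : ∀ {u} → u ∈ ∁ classN → degree G u ≡ n
    degree-∁N {u} u∈ = degree-M (subst (u ∈_) ∁N≡M u∈)

    degree-∁M : ∀ {u} → u ∈ ∁ classM → degree G u ≡ m
    degree-∁M {u} u∈ = degree-N (subst (u ∈_) ∁M≡N u∈)

    bipartition : Tri (n < m) (n ≡ m) (m < n) → IsCompleteBipartition G classN
    -- Vertices outside `classN` have degree `n`, and an edge between two of them would force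
    -- `m ≤ n`.
    bipartition (tri< n<m _ _) = independent-side⇒bipartition G {m} {n} degree-N degree-∁N ∣N∣≡n ∣∁N∣≡m
      λ u∈ v∈ uv → ℕₚ.<⇒≱ n<m (proj₂ (edge-degree-bounds N≡n+m (degree-∁N u∈) (degree-∁N v∈) uv))
    bipartition (tri≈ _ n≡m _) = contradiction n≡m n≢m
    -- Now `classN` has the smaller degree and is the independent side; the bipartition obtained for
    -- `classM` is complemented.
    bipartition (tri> _ _ m<n) = subst (IsCompleteBipartition G) ∁M≡N (∁-isCompleteBipartition G
      (independent-side⇒bipartition G {n} {m} degree-M degree-∁M ∣M∣≡m (trans (cong ∣_∣ ∁M≡N) ∣N∣≡n)
        λ u∈ v∈ uv → ℕₚ.<⇒≱ m<n (proj₁ (edge-degree-bounds N≡n+m (degree-∁M u∈) (degree-∁M v∈) uv))))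

-- Both linear terms have exponent `n`, so a single class of size `n + n` holds every vertex and `G`
-- is `n`-regular. As `n` is positive there is an edge, from whose end `x` the sides are read off.
da≈⇒bipartition-≡ : ∀ {n} .{{_ : NonZero n}} (G : Graph) → da G ≈ bipartitePoly n n →
  ∃ λ A → IsCompleteBipartition G A × ∣ A ∣ ≡ n × ∣ ∁ A ∣ ≡ n
da≈⇒bipartition-≡ {n} G da≈ = neighbours G x ,
    triangle-free⇒bipartition G regular N≡n+n triangle-free (∈-neighbours⁻ G (proj₂ y)) , regular x ,
    ℕₚ.+-cancelˡ-≡ n _ _ (trans (cong (_+ ∣ ∁ (neighbours G x) ∣) (sym (regular x)))
      (trans (∣p∣+∣∁p∣≡n (neighbours G x)) N≡n+n))
  where
  all-exponents : ∀ u → u ∈ exponentClass G (ℤ.+ n)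
  all-exponents u = ∈-exponentClass⁺ G (ℤ.+ n) (Sum.reduce (exponent-cases G da≈ u))

  N≡n+n : order G ≡ n + n
  N≡n+n = begin
    order G                        ≡⟨ ∣⊤∣≡n (order G) ⟨
    ∣ ⊤ {order G} ∣                ≡⟨ cong ∣_∣ (⊆-antisym ⊆⊤ λ {u} _ → all-exponents u) ⟨
    ∣ exponentClass G (ℤ.+ n) ∣    ≡⟨ exponentClass-size G da≈ (ℤ.+ n) ⟩
    _                              ≡⟨ cong (λ x → n * x + n * x) (indicator-yes {ℤ.+ n} refl) ⟩
    n * 1 + n * 1                  ≡⟨ cong₂ _+_ (ℕₚ.*-identityʳ n) (ℕₚ.*-identityʳ n) ⟩
    n + n                          ∎
    where open ≡-Reasoning

  regular : ∀ u → degree G u ≡ n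
  regular u = exponent⇒degree G N≡n+n (∈-exponentClass⁻ G (ℤ.+ n) (all-exponents u))

  x : Vertex G
  x = proj₁ (0<∣p∣⇒Nonempty (⊤ {order G})
    (subst (0 <_) (sym (trans (∣⊤∣≡n (order G)) N≡n+n)) (ℕₚ.≤-trans (>-nonZero⁻¹ n) (ℕₚ.m≤m+n n n))))

  y : Nonempty (neighbours G x)
  y = 0<∣p∣⇒Nonempty (neighbours G x) (subst (0 <_) (sym (regular x)) (>-nonZero⁻¹ n))

  triangle-free : ∀ {u v w} → Adj G u v → Adj G u w → ¬ Adj G v w
  triangle-free {u} {v} {w} uv uw vw =
    case clique-degree-bounds G da≈ N≡n+n clique size (λ {z} _ → regular z) of λ where
      -- From `1 ≡ i + j` one index is 0, and its bound would say `4 + n ≤ 2 + n`.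
      (0 , _ , _ , 4+n≤2+n , _) → ℕₚ.<⇒≱ (ℕₚ.+-monoˡ-< n {2} {4} (s≤s (s≤s (s≤s z≤n)))) 4+n≤2+n
      (1 , 0 , _ , _ , 4+n≤2+n) → ℕₚ.<⇒≱ (ℕₚ.+-monoˡ-< n {2} {4} (s≤s (s≤s (s≤s z≤n)))) 4+n≤2+n
    where
    ≢ : ∀ {a b} → Adj G a b → a ≢ b
    ≢ ab refl = adj-irrefl G ab
    vw-clique : Clique G (⁅ v ⁆ ∪ ⁅ w ⁆)
    vw-clique = ∪-clique G (λ z∈ → subst (Adj G v) (sym (x∈⁅y⁆⇒x≡y w z∈)) vw) (⁅⁆-clique G w)
    u-edges : ∀ {z} → z ∈ ⁅ v ⁆ ∪ ⁅ w ⁆ → Adj G u z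
    u-edges z∈ with x∈p∪q⁻ ⁅ v ⁆ ⁅ w ⁆ z∈
    ... | inj₁ z∈v = subst (Adj G u) (sym (x∈⁅y⁆⇒x≡y v z∈v)) uv
    ... | inj₂ z∈w = subst (Adj G u) (sym (x∈⁅y⁆⇒x≡y w z∈w)) uw
    clique : Clique G (⁅ u ⁆ ∪ (⁅ v ⁆ ∪ ⁅ w ⁆))
    clique = ∪-clique G u-edges vw-clique
    size : ∣ ⁅ u ⁆ ∪ (⁅ v ⁆ ∪ ⁅ w ⁆) ∣ ≡ 3
    size = trans (∣⁅x⁆∪p∣≡1+∣p∣ {x = u} {⁅ v ⁆ ∪ ⁅ w ⁆} λ u∈ → adj-irrefl G (u-edges u∈)) (cong suc
      (trans (∣⁅x⁆∪p∣≡1+∣p∣ {x = v} {⁅ w ⁆} (x≢y⇒x∉⁅y⁆ (≢ vw))) (cong suc (∣⁅x⁆∣≡1 w))))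

-- Complete bipartitions and isomorphism with `completeBipartite`.

onLeft : ∀ {A B : Set} → A ⊎ B → Bool
onLeft = [ const true , const false ]′

onLeft-map : ∀ {A B C D : Set} {f : A → C} {g : B → D} (x : A ⊎ B) → onLeft (Sum.map f g x) ≡ onLeft x
onLeft-map (inj₁ _) = refl
onLeft-map (inj₂ _) = refl

opposite-of-left : ∀ {A B : Set} (x y : A ⊎ B) → onLeft x ≡ true → does (oppositeSides? x y) ≡ not (onLeft y)
opposite-of-left (inj₁ _) (inj₁ _) _ = refl
opposite-of-left (inj₁ _) (inj₂ _) _ = refl

opposite-of-right : ∀ {A B : Set} (x y : A ⊎ B) → onLeft x ≡ false → does (oppositeSides? x y) ≡ onLeft y
opposite-of-right (inj₂ _) (inj₁ _) _ = refl
opposite-of-right (inj₂ _) (inj₂ _) _ = refl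

∣left∣≡n : ∀ n m → ∣ tabulate (onLeft ∘ splitAt n {m}) ∣ ≡ n
∣left∣≡n zero    zero    = refl
∣left∣≡n zero    (suc m) = ∣left∣≡n zero m
∣left∣≡n (suc n) m       = cong suc (trans
  (cong ∣_∣ (tabulate-cong λ i → onLeft-map (splitAt n {m} i))) (∣left∣≡n n m))

∣tabulate∣-permute : ∀ {k l} (f : Fin l → Bool) (φ : Fin k ↔ Fin l) →
                     ∣ tabulate (f ∘ Inverse.to φ) ∣ ≡ ∣ tabulate f ∣
∣tabulate∣-permute f φ = trans (∣tabulate∣ (f ∘ Inverse.to φ))
  (trans (sym (sum-permute (indicator ∘ f) φ)) (sym (∣tabulate∣ f)))

-- `A` is the preimage of the left side. Its size transfers along `φ`, which also gives the order
-- `n + m` and so the size of `∁ A`.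
≅⇒bipartition : ∀ {n m} .{{_ : NonZero n}} (G : Graph) → G ≅ completeBipartite n m →
  ∃ λ A → IsCompleteBipartition G A × ∣ A ∣ ≡ n × ∣ ∁ A ∣ ≡ m
≅⇒bipartition {n} {m} G (φ , adj⇔) = A , bip , ∣A∣≡n ,
    ℕₚ.+-cancelˡ-≡ n _ _ (trans (cong (_+ ∣ ∁ A ∣) (sym ∣A∣≡n)) (trans (∣p∣+∣∁p∣≡n A) (↔⇒≡ φ)))
  where
  side : Vertex G → Fin n ⊎ Fin m
  side = splitAt n ∘ Inverse.to φ

  A : Subset (order G)
  A = tabulate (onLeft ∘ side)

  ∣A∣≡n : ∣ A ∣ ≡ n
  ∣A∣≡n = trans (∣tabulate∣-permute (onLeft ∘ splitAt n) φ) (∣left∣≡n n m)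

  -- `neighbours` is tabulated from `does`, so the equivalence of adjacencies is needed between
  -- Booleans.
  adj≡opposite : ∀ u v → does (adj? G u v) ≡ does (oppositeSides? (side u) (side v))
  adj≡opposite u v = does-⇔ (adj⇔ u v) (adj? G u v) (oppositeSides? (side u) (side v))

  bip : IsCompleteBipartition G A
  bip = record
    { neighbours-inside = λ {u} u∈A → trans
        (tabulate-cong λ v → trans (adj≡opposite u v) (opposite-of-left (side u) (side v) (∈-tabulate⁻ u∈A)))
        (tabulate-∘ not (onLeft ∘ side))
    ; neighbours-outside = λ {u} u∈∁A → tabulate-cong λ v → trans (adj≡opposite u v)
        (opposite-of-right (side u) (side v)
          (¬-not λ left → x∈∁p⇒x∉p u∈∁A (∈-tabulate⁺ left)))
    }

-- Each vertex is sent to its rank among the vertices of its own side.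
index : (A : Subset k) → Fin k → Fin ∣ A ∣ ⊎ Fin ∣ ∁ A ∣
index (inside ∷ A)  zero    = inj₁ zero
index (inside ∷ A)  (suc u) = Sum.map₁ suc (index A u)
index (outside ∷ A) zero    = inj₂ zero
index (outside ∷ A) (suc u) = Sum.map₂ suc (index A u)

element : (A : Subset k) → Fin ∣ A ∣ ⊎ Fin ∣ ∁ A ∣ → Fin k
element (inside ∷ A)  (inj₁ zero)    = zero
element (inside ∷ A)  (inj₁ (suc i)) = suc (element A (inj₁ i))
element (inside ∷ A)  (inj₂ j)       = suc (element A (inj₂ j))
element (outside ∷ A) (inj₁ i)       = suc (element A (inj₁ i))
element (outside ∷ A) (inj₂ zero)    = zero
element (outside ∷ A) (inj₂ (suc j)) = suc (element A (inj₂ j))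

index-element : ∀ (A : Subset k) x → index A (element A x) ≡ x
index-element (inside ∷ A)  (inj₁ zero)    = refl
index-element (inside ∷ A)  (inj₁ (suc i)) = cong (Sum.map₁ suc) (index-element A (inj₁ i))
index-element (inside ∷ A)  (inj₂ j)       = cong (Sum.map₁ suc) (index-element A (inj₂ j))
index-element (outside ∷ A) (inj₁ i)       = cong (Sum.map₂ suc) (index-element A (inj₁ i))
index-element (outside ∷ A) (inj₂ zero)    = refl
index-element (outside ∷ A) (inj₂ (suc j)) = cong (Sum.map₂ suc) (index-element A (inj₂ j))

element-index : ∀ (A : Subset k) u → element A (index A u) ≡ u
element-index (inside ∷ A)  zero    = refl
element-index (inside ∷ A)  (suc u) with index A u | element-index A u
... | inj₁ _ | refl = refl
... | inj₂ _ | refl = refl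
element-index (outside ∷ A) zero    = refl
element-index (outside ∷ A) (suc u) with index A u | element-index A u
... | inj₁ _ | refl = refl
... | inj₂ _ | refl = refl

onLeft-index : ∀ (A : Subset k) u → onLeft (index A u) ≡ lookup A u
onLeft-index (inside ∷ A)  zero    = refl
onLeft-index (inside ∷ A)  (suc u) = trans (onLeft-map (index A u)) (onLeft-index A u)
onLeft-index (outside ∷ A) zero    = refl
onLeft-index (outside ∷ A) (suc u) = trans (onLeft-map (index A u)) (onLeft-index A u)

index-↔ : (A : Subset k) → Fin k ↔ (Fin ∣ A ∣ ⊎ Fin ∣ ∁ A ∣)
index-↔ A = mk↔ₛ′ (index A) (element A) (index-element A) (element-index A)

bipartition⇒≅ : ∀ {n m} .{{_ : NonZero n}} (G : Graph) {A} → IsCompleteBipartition G A →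
  ∣ A ∣ ≡ n → ∣ ∁ A ∣ ≡ m → G ≅ completeBipartite n m
bipartition⇒≅ G {A} bip refl refl = ↔-sym +↔⊎ ↔-∘ index-↔ A , λ u v →
  -- Splitting a joined index gives back `index A`, so sides need only be compared there.
  subst₂ (λ x y → Adj G u v ⇔ OppositeSides x y)
    (sym (splitAt-join ∣ A ∣ ∣ ∁ A ∣ (index A u))) (sym (splitAt-join ∣ A ∣ ∣ ∁ A ∣ (index A v)))
    (mk⇔ (λ uv → does≡true⇒ (oppositeSides? (index A u) (index A v)) (trans (sym (adj≡opposite u v)) (dec-true (adj? G u v) uv)))
         (λ op → does≡true⇒ (adj? G u v) (trans (adj≡opposite u v) (dec-true (oppositeSides? (index A u) (index A v)) op))))
  where
  open IsCompleteBipartition bip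

  does≡true⇒ : ∀ {P : Set} (P? : Dec P) → does P? ≡ true → P
  does≡true⇒ (yes p) _ = p

  adj≡lookup : ∀ u v → does (adj? G u v) ≡ lookup (neighbours G u) v
  adj≡lookup u v = sym (lookup∘tabulate (does ∘ adj? G u) v)

  adj≡opposite : ∀ u v → does (adj? G u v) ≡ does (oppositeSides? (index A u) (index A v))
  adj≡opposite u v with u ∈? A
  ... | yes u∈A = begin
    does (adj? G u v)             ≡⟨ adj≡lookup u v ⟩
    lookup (neighbours G u) v     ≡⟨ cong (λ p → lookup p v) (neighbours-inside u∈A) ⟩
    lookup (∁ A) v                ≡⟨ lookup-map v not A ⟩
    not (lookup A v)              ≡⟨ cong not (onLeft-index A v) ⟨
    not (onLeft (index A v))      ≡⟨ opposite-of-left (index A u) (index A v) (trans (onLeft-index A u) ([]=⇒lookup u∈A)) ⟨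
    does (oppositeSides? (index A u) (index A v)) ∎
    where open ≡-Reasoning
  ... | no u∉A = begin
    does (adj? G u v)             ≡⟨ adj≡lookup u v ⟩
    lookup (neighbours G u) v     ≡⟨ cong (λ p → lookup p v) (neighbours-outside (x∉p⇒x∈∁p u∉A)) ⟩
    lookup A v                    ≡⟨ onLeft-index A v ⟨
    onLeft (index A v)            ≡⟨ opposite-of-right (index A u) (index A v)
                                       (trans (onLeft-index A u) (¬-not (u∉A ∘ lookup⇒[]= u A))) ⟨
    does (oppositeSides? (index A u) (index A v)) ∎
    where open ≡-Reasoning

-- For `n = m` the degrees do not separate the sides, hence the two cases.
da≈⇒bipartition : ∀ {n m} .{{_ : NonZero n}} (G : Graph) → da G ≈ bipartitePoly n m →
  ∃ λ A → IsCompleteBipartition G A × ∣ A ∣ ≡ n × ∣ ∁ A ∣ ≡ m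
da≈⇒bipartition {n} {m} G da≈ with n ℕₚ.≟ m
... | yes refl = da≈⇒bipartition-≡ G da≈
... | no n≢m   = da≈⇒bipartition-≢ G da≈ n≢m

proposition30 : (n m : ℕ) → .{{_ : NonZero n}} → .{{_ : NonZero m}} → (G : Graph) →
    G ≅ completeBipartite n m ⇔ da G ≈ bipartitePoly n m
proposition30 n m G = mk⇔
  (λ G≅K → case ≅⇒bipartition G G≅K of λ where
    (A , bip , ∣A∣≡n , ∣∁A∣≡m) → bipartition⇒da≈ G bip ∣A∣≡n ∣∁A∣≡m)
  (λ da≈ → case da≈⇒bipartition G da≈ of λ where
    (A , bip , ∣A∣≡n , ∣∁A∣≡m) → bipartition⇒≅ G bip ∣A∣≡n ∣∁A∣≡m)
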